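{- Let $D_0$ be a northeast diagram. Then the Kohnert poset $\mathcal{P}(D_0)$ is ranked if and only if $D_0$ does not contain cells $x_1=(r_1,c_1)$, $x_2=(r_2,c_2)$, $x_3=(r_3,c_3)$ such that: (a) $r_1<r_2\le r_3$; (b) $c_1=c_2<c_3$; (c) for each column $c$ with $c_1\le c<c_3$, there is at least one empty position $(r,c)$ (i.e. $(r,c)\notin D_0$) with $r<r_1$; and (d) for each column $c\ge c_3$, the number of $r<r_3$ such that $(r,c)\in D_0$ is strictly less than $r_1$.
   Context: A diagram is a finite subset of $\mathbb{N}\times\mathbb{N}$ ($\mathbb{N}=\{1,2,\dots\}$); an element $(r,c)$ is a cell in row $r$ and column $c$, rows numbered bottom to top; a position is empty if not in the diagram. A Kohnert move on $D$ selects a row, takes the rightmost cell $(r,c)$ of $D$ in that row, and moves it to $(r',c)$ where $r'$ is the largest $1\le r'<r$ with $(r',c)\notin D$ (no move if none exists). The Kohnert poset $\mathcal{P}(D)$ is the set of diagrams obtainable from $D$ by finitely many Kohnert moves (including $D$), ordered by the transitive closure of $D_2<D_1$ whenever $D_2$ results from $D_1$ by one Kohnert move. A poset $P$ is ranked if there is a function $\rho:P\to\mathbb{Z}_{\ge0}$ with $\rho(x)<\rho(y)$ whenever $x<y$ and $\rho(y)=\rho(x)+1$ whenever $y$ covers $x$ (minimal elements need not have rank $0$); equivalently, for all $x\le y$ all maximal chains from $x$ to $y$ have the same length. A diagram $D$ is northeast if for all cells $(r_1,c_1),(r_2,c_2)\in D$, $(\max(r_1,r_2),\max(c_1,c_2))\in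 D$. -}

module Defs where

open import Data.Nat using (ℕ; zero; suc; _≤_; _<_; _⊔_; pred)
open import Data.Nat.Properties using () renaming (_≟_ to _≟ℕ_)
open import Data.Product using (Σ; ∃; ∃-syntax; _×_; _,_)
open import Data.Product.Properties using (≡-dec)
open import Data.Sum using (_⊎_)
open import Data.List using (List; length; filter; applyUpTo)
open import Data.List.Relation.Unary.All using (All)
open import Relation.Nullary using (¬_)
open import Relation.Binary.PropositionalEquality using (_≡_; _≢_)
open import Function.Bundles using (_⇔_)

-- A cell (r , c): row r, column c (rows numbered bottom to top).
Cell : Set
Cell = ℕ × ℕ

_≟C_ : (x y : Cell) → Relation.Nullary.Dec (x ≡ y)
_≟C_ = ≡-dec _≟ℕ_ _≟ℕ_

open import Data.List.Membership.DecPropositional _≟C_ public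
  using (_∈_; _∉_; _∈?_)

-- A diagram is a finite set of cells, presented by a list of cells.
-- Two lists present the same diagram iff they have the same members.
Diagram : Set
Diagram = List Cell

-- All cells lie in ℕ⁺ × ℕ⁺ (ℕ = {1,2,...} in the paper).
Positive : Diagram → Set
Positive D = All (λ x → 1 ≤ Data.Product.proj₁ x × 1 ≤ Data.Product.proj₂ x) D

_≈D_ : Diagram → Diagram → Set
D ≈D E = ∀ x → (x ∈ D) ⇔ (x ∈ E)

KMove : Diagram → Diagram → Set
KMove D E =
  Σ ℕ λ r → Σ ℕ λ c → Σ ℕ λ r' →
    ((r , c) ∈ D)
  × (∀ c' → (r , c') ∈ D → c' ≤ c)
  × (1 ≤ r') × (r' < r) × ((r' , c) ∉ D)
  × (∀ r'' → r' < r'' → r'' < r → (r'' , c) ∈ D)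
  × (∀ x → (x ∈ E) ⇔ (((x ∈ D) × (x ≢ (r , c))) ⊎ (x ≡ (r' , c))))

data _⟶*_ : Diagram → Diagram → Set where
  done : ∀ {D E} → D ≈D E → D ⟶* E
  step : ∀ {D E F} → KMove D E → E ⟶* F → D ⟶* F

-- D ⟶+ E : at least one move (E < D in the Kohnert poset).
_⟶+_ : Diagram → Diagram → Set
D ⟶+ F = Σ Diagram λ E → KMove D E × (E ⟶* F)

InP : Diagram → Diagram → Set
InP D₀ D = D₀ ⟶* D

Covers : Diagram → Diagram → Set
Covers y x = (y ⟶+ x) × ¬ (Σ Diagram λ z → (y ⟶+ z) × (z ⟶+ x))

Ranked : Diagram → Set
Ranked D₀ = Σ (Diagram → ℕ) λ ρ →
    (∀ x y → InP D₀ x → InP D₀ y → x ≈D y → ρ x ≡ ρ y)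
  × (∀ x y → InP D₀ x → InP D₀ y → y ⟶+ x → ρ x < ρ y)
  × (∀ x y → InP D₀ x → InP D₀ y → Covers y x → ρ y ≡ suc (ρ x))

Northeast : Diagram → Set
Northeast D = ∀ r₁ c₁ r₂ c₂ → (r₁ , c₁) ∈ D → (r₂ , c₂) ∈ D →
  (r₁ ⊔ r₂ , c₁ ⊔ c₂) ∈ D

countBelow : Diagram → ℕ → ℕ → ℕ
countBelow D r₃ c = length (filter (λ r → (r , c) ∈? D) (applyUpTo suc (pred r₃)))

Pattern : Diagram → Set
Pattern D = Σ ℕ λ r₁ → Σ ℕ λ c₁ → Σ ℕ λ r₂ → Σ ℕ λ r₃ → Σ ℕ λ c₃ →
    ((r₁ , c₁) ∈ D) × ((r₂ , c₁) ∈ D) × ((r₃ , c₃) ∈ D)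
  × (r₁ < r₂) × (r₂ ≤ r₃)
  × (c₁ < c₃)
  × (∀ c → c₁ ≤ c → c < c₃ → Σ ℕ λ r → (1 ≤ r) × (r < r₁) × ((r , c) ∉ D))
  × (∀ c → c₃ ≤ c → countBelow D r₃ c < r₁)

{-# OPTIONS --safe #-}

-- If D₀ has no pattern, the sum of the rows of all cells is a rank function.  This
-- amounts to showing that every cell directly below a jumping cell is itself free
-- to move, so that no jump is a cover.  Order the cells of each column from bottom
-- to top.  If a cell of column c starts in the same row as a cell of column d > c,
-- it never gets below that cell.  Hence the cells of D₀ with the same indices as a
-- jumping cell, the cell below it and a cell blocking the latter form a pattern.
--
-- Conversely, unit moves are covers, so a rank function differs from the row sum by
-- a constant along unit moves.  A pattern allows one to reach a diagram from which
-- two move sequences lead to the same diagram, one made of unit moves only, the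
-- other containing in addition a cover that drops the row sum by two.
module Submission where

open import Defs
open import Data.Empty using (⊥)
open import Data.List using ([]; _∷_; filter; length; applyUpTo; map; deduplicate)
open import Data.List.Extrema.Nat using (max; xs≤max)
open import Data.List.Membership.Propositional using (find; lose)
open import Data.List.Membership.Propositional.Properties using (∈-filter⁺; ∈-filter⁻; ∈-deduplicate⁺; ∈-deduplicate⁻; ∈-map⁺)
open import Data.List.Membership.Propositional.Properties.WithK using (unique∧set⇒bag)
open import Data.List.Properties using (filter-++; length-++; applyUpTo-∷ʳ)
open import Data.List.Relation.Binary.BagAndSetEquality using (∼bag⇒↭)
open import Data.List.Relation.Binary.Permutation.Propositional.Properties using (map⁺)
open import Data.List.Relation.Unary.All as All using (All)
open import Data.List.Relation.Unary.All.Properties using (¬Any⇒All¬)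
open import Data.List.Relation.Unary.AllPairs using (_∷_)
open import Data.List.Relation.Unary.Any using (here; there; any?)
open import Data.List.Relation.Unary.Unique.DecPropositional.Properties _≟C_ using (deduplicate-!)
open import Data.List.Relation.Unary.Unique.Propositional using (Unique)
open import Data.Nat using (ℕ; zero; suc; _+_; _∸_; _≤_; _<_; _⊔_; z≤n; s≤s; _≤?_; _<?_)
open import Data.Nat.ListAction using (sum)
open import Data.Nat.ListAction.Properties using (sum-↭)
open import Data.Nat.Properties
open import Data.Nat.Solver using (module +-*-Solver)
open import Data.Product using (Σ; ∃-syntax; _×_; _,_; proj₁; proj₂)
open import Data.Sum using (_⊎_; inj₁; inj₂)
open import Function.Base using (_∘_)
open import Function.Bundles using (_⇔_; mk⇔; Equivalence)
import Function.Properties.Equivalence as ⇔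
open import Relation.Binary.Definitions using (tri<; tri≈; tri>)
open import Relation.Binary.PropositionalEquality using (_≡_; _≢_; refl; sym; trans; cong; cong₂; subst; ≢-sym; module ≡-Reasoning)
open import Relation.Nullary using (¬_; Dec; yes; no; contradiction)
open import Relation.Nullary.Decidable using (¬?; _×-dec_)

open Equivalence using (to; from)

-- Replacing one cell of a diagram

≈D-refl : ∀ {D} → D ≈D D
≈D-refl _ = ⇔.refl

Moved : Cell → Cell → Diagram → Diagram → Set
Moved x y D E = ∀ z → (z ∈ E) ⇔ ((z ∈ D × z ≢ x) ⊎ z ≡ y)

module _ {x y D E} (mv : Moved x y D E) where

  moved-new : y ∈ E
  moved-new = from (mv y) (inj₂ refl)

  moved-keep : ∀ {z} → z ∈ D → z ≢ x → z ∈ E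
  moved-keep z∈D z≢x = from (mv _) (inj₁ (z∈D , z≢x))

  moved-old : ∀ {z} → z ∈ E → z ≢ y → z ∈ D
  moved-old z∈E z≢y with to (mv _) z∈E
  ... | inj₁ (z∈D , _) = z∈D
  ... | inj₂ z≡y = contradiction z≡y z≢y

  moved-gone : x ≢ y → x ∉ E
  moved-gone x≢y x∈E with to (mv _) x∈E
  ... | inj₁ (_ , x≢x) = x≢x refl
  ... | inj₂ x≡y = x≢y x≡y

  moved-agree : ∀ {z} → z ≢ x → z ≢ y → (z ∈ D) ⇔ (z ∈ E)
  moved-agree z≢x z≢y = mk⇔ (λ z∈D → moved-keep z∈D z≢x) (λ z∈E → moved-old z∈E z≢y)

move : Cell → Cell → Diagram → Diagram
move x y D = y ∷ filter (λ z → ¬? (z ≟C x)) D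

move-moved : ∀ x y D → Moved x y D (move x y D)
move-moved x y D z = mk⇔
  (λ { (here z≡y) → inj₂ z≡y
     ; (there z∈) → inj₁ (∈-filter⁻ (λ z → ¬? (z ≟C x)) z∈) })
  (λ { (inj₁ (z∈D , z≢x)) → there (∈-filter⁺ (λ z → ¬? (z ≟C x)) z∈D z≢x)
     ; (inj₂ z≡y) → here z≡y })

KMove-respʳ : ∀ {D E F} → KMove D E → E ≈D F → KMove D F
KMove-respʳ (r , c , r' , p , right , 1≤r' , r'<r , r'∉ , run , mv) E≈F =
  r , c , r' , p , right , 1≤r' , r'<r , r'∉ , run , λ z → ⇔.trans (⇔.sym (E≈F z)) (mv z)

-- The row sum

-- Duplicates are removed because a list may repeat a cell, while a rank function must agree on
-- lists presenting the same diagram.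
rowSum : Diagram → ℕ
rowSum D = sum (map proj₁ (deduplicate _≟C_ D))

∈-dedup : ∀ {x} D → (x ∈ D) ⇔ (x ∈ deduplicate _≟C_ D)
∈-dedup D = mk⇔ (∈-deduplicate⁺ _≟C_) (∈-deduplicate⁻ _≟C_ D)

sumRows-unique : ∀ {D E} → Unique D → Unique E → D ≈D E → sum (map proj₁ D) ≡ sum (map proj₁ E)
sumRows-unique uD uE D≈E =
  sum-↭ (map⁺ proj₁ (∼bag⇒↭ (unique∧set⇒bag uD uE (λ {x} → D≈E x))))

rowSum-cong : ∀ {D E} → D ≈D E → rowSum D ≡ rowSum E
rowSum-cong {D} {E} D≈E = sumRows-unique (deduplicate-! D) (deduplicate-! E)
  (λ x → ⇔.trans (⇔.sym (∈-dedup D)) (⇔.trans (D≈E x) (∈-dedup E)))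

-- Both x ∷ E and y ∷ D list the set D ∪ {y} without repetition.
rowSum-moved : ∀ {x y D E} → x ∈ D → y ∉ D → Moved x y D E →
  proj₁ x + rowSum E ≡ proj₁ y + rowSum D
rowSum-moved {x} {y} {D} {E} x∈D y∉D mv =
  sumRows-unique (fresh x∉E ∷ deduplicate-! E) (fresh y∉D ∷ deduplicate-! D)
    (λ z → mk⇔ (E⊆ z) (D⊆ z))
  where
  x∉E : x ∉ E
  x∉E = moved-gone mv λ { refl → y∉D x∈D }
  fresh : ∀ {x D} → x ∉ D → All (x ≢_) (deduplicate _≟C_ D)
  fresh {D = D} x∉D = ¬Any⇒All¬ _ (x∉D ∘ from (∈-dedup D))
  E⊆ : ∀ z → z ∈ (x ∷ deduplicate _≟C_ E) → z ∈ (y ∷ deduplicate _≟C_ D)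
  E⊆ z (here refl) = there (to (∈-dedup D) x∈D)
  E⊆ z (there z∈) with z ≟C y
  ... | yes z≡y = here z≡y
  ... | no z≢y = there (to (∈-dedup D) (moved-old mv (from (∈-dedup E) z∈) z≢y))
  D⊆ : ∀ z → z ∈ (y ∷ deduplicate _≟C_ D) → z ∈ (x ∷ deduplicate _≟C_ E)
  D⊆ z (here refl) = there (to (∈-dedup E) (moved-new mv))
  D⊆ z (there z∈) with z ≟C x
  ... | yes z≡x = here z≡x
  ... | no z≢x = there (to (∈-dedup E) (moved-keep mv (from (∈-dedup D) z∈) z≢x))

rowSum-KMove : ∀ {D E} → KMove D E → rowSum E < rowSum D
rowSum-KMove {D} {E} (r , c , r' , rc∈D , _ , _ , r'<r , r'c∉D , _ , mv) =
  +-cancelˡ-< r' _ _ (begin-strict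
    r' + rowSum E <⟨ +-monoˡ-< (rowSum E) r'<r ⟩
    r + rowSum E  ≡⟨ rowSum-moved rc∈D r'c∉D mv ⟩
    r' + rowSum D ∎)
  where open ≤-Reasoning

rowSum-⟶* : ∀ {D E} → D ⟶* E → rowSum E ≤ rowSum D
rowSum-⟶* (done D≈E) = ≤-reflexive (sym (rowSum-cong D≈E))
rowSum-⟶* (step m s) = ≤-trans (rowSum-⟶* s) (<⇒≤ (rowSum-KMove m))

rowSum-⟶+ : ∀ {D E} → D ⟶+ E → rowSum E < rowSum D
rowSum-⟶+ (_ , m , s) = ≤-<-trans (rowSum-⟶* s) (rowSum-KMove m)

-- Column counts

-- The shift makes row x itself count; for r₃ = m + 1 the bound in (d) is `N D c m < r₁` by
-- definition.
N : Diagram → ℕ → ℕ → ℕ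
N D c x = countBelow D (suc x) c

module _ (D : Diagram) (c : ℕ) where

  private
    P? : (r : ℕ) → Dec ((r , c) ∈ D)
    P? r = (r , c) ∈? D

    N-suc : ∀ x → N D c (suc x) ≡ N D c x + length (filter P? (suc x ∷ []))
    N-suc x = trans (cong (length ∘ filter P?) (sym (applyUpTo-∷ʳ suc x)))
      (trans (cong length (filter-++ P? (applyUpTo suc x) (suc x ∷ [])))
        (length-++ (filter P? (applyUpTo suc x))))

  N-yes : ∀ {x} → (suc x , c) ∈ D → N D c (suc x) ≡ suc (N D c x)
  N-yes {x} x∈D with P? (suc x) | N-suc x
  ... | yes _ | eq = trans eq (+-comm _ 1)
  ... | no x∉D | _ = contradiction x∈D x∉D

  N-no : ∀ {x} → (suc x , c) ∉ D → N D c (suc x) ≡ N D c x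
  N-no {x} x∉D with P? (suc x) | N-suc x
  ... | yes x∈D | _ = contradiction x∈D x∉D
  ... | no _ | eq = trans eq (+-identityʳ _)

  N≤N-suc : ∀ x → N D c x ≤ N D c (suc x)
  N≤N-suc x with P? (suc x)
  ... | yes x∈D = ≤-trans (n≤1+n _) (≤-reflexive (sym (N-yes x∈D)))
  ... | no x∉D = ≤-reflexive (sym (N-no x∉D))

  N-suc≤ : ∀ x → N D c (suc x) ≤ suc (N D c x)
  N-suc≤ x with P? (suc x)
  ... | yes x∈D = ≤-reflexive (N-yes x∈D)
  ... | no x∉D = ≤-trans (≤-reflexive (N-no x∉D)) (n≤1+n _)

  N-≤-+ : ∀ k x → N D c x ≤ N D c (k + x)
  N-≤-+ zero x = ≤-refl
  N-≤-+ (suc k) x = ≤-trans (N-≤-+ k x) (N≤N-suc (k + x))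

  N-mono : ∀ {x y} → x ≤ y → N D c x ≤ N D c y
  N-mono {x} {y} x≤y = subst (λ z → N D c x ≤ N D c z) (m∸n+n≡m x≤y) (N-≤-+ (y ∸ x) x)

  N-lip : ∀ k x → N D c (k + x) ≤ k + N D c x
  N-lip zero x = ≤-refl
  N-lip (suc k) x = ≤-trans (N-suc≤ (k + x)) (s≤s (N-lip k x))

  N≤ : ∀ x → N D c x ≤ x
  N≤ zero = z≤n
  N≤ (suc x) = ≤-trans (N-suc≤ x) (s≤s (N≤ x))

  N-hole : ∀ {t x} → 1 ≤ t → t ≤ x → (t , c) ∉ D → N D c x < x
  N-hole {suc t} {suc x} 1≤t t≤x t∉D with suc t ≟ suc x
  ... | yes refl = s≤s (≤-trans (≤-reflexive (N-no t∉D)) (N≤ x))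
  ... | no t≢x = ≤-<-trans (N-suc≤ x) (s≤s (N-hole 1≤t (≤-pred (≤∧≢⇒< t≤x t≢x)) t∉D))

  N-run : ∀ k x → (∀ y → x < y → y ≤ k + x → (y , c) ∈ D) → N D c (k + x) ≡ k + N D c x
  N-run zero x run = refl
  N-run (suc k) x run = trans (N-yes (run _ (s≤s (m≤n+m x k)) ≤-refl))
    (cong suc (N-run k x (λ y x<y y≤ → run y x<y (m≤n⇒m≤1+n y≤))))

  -- The scan down from row x stops where the count passes from k to k + 1, at the cell with exactly
  -- k cells below it in its column.
  N-find : ∀ k x → k < N D c x → ∃[ a ] (suc a , c) ∈ D × a < x × N D c a ≡ k
  N-find k (suc x) k<N with k <? N D c x
  ... | yes k<N' with a , a∈D , a<x , Na ← N-find k x k<N' = a , a∈D , m<n⇒m<1+n a<x , Na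
  ... | no k≮N' with P? (suc x)
  ...   | yes x∈D = x , x∈D , ≤-refl ,
            ≤-antisym (≮⇒≥ k≮N') (≤-pred (subst (k <_) (N-yes x∈D) k<N))
  ...   | no x∉D = contradiction (subst (k <_) (N-no x∉D) k<N) k≮N'

  hole? : ∀ x → (∃[ t ] 1 ≤ t × t ≤ x × (t , c) ∉ D) ⊎ N D c x ≡ x
  hole? zero = inj₂ refl
  hole? (suc x) with P? (suc x)
  ... | no x∉D = inj₁ (suc x , s≤s z≤n , ≤-refl , x∉D)
  ... | yes x∈D with hole? x
  ...   | inj₁ (t , 1≤t , t≤x , t∉D) = inj₁ (t , 1≤t , m≤n⇒m≤1+n t≤x , t∉D)
  ...   | inj₂ eq = inj₂ (trans (N-yes x∈D) (cong suc eq))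

  -- Row r is where a Kohnert move of (s , c) lands.
  highestHole : ∀ {t} s → 1 ≤ t → t < s → (t , c) ∉ D →
    ∃[ r ] 1 ≤ r × r < s × (r , c) ∉ D × (∀ y → r < y → y < s → (y , c) ∈ D)
  highestHole {t} (suc s) 1≤t t<s t∉D with P? s
  ... | no s∉D = s , ≤-trans 1≤t (≤-pred t<s) , ≤-refl , s∉D ,
          λ y s<y y<s → contradiction (≤-trans y<s s<y) (<-irrefl refl)
  ... | yes s∈D with r , 1≤r , r<s , r∉D , run ←
            highestHole s 1≤t (≤∧≢⇒< (≤-pred t<s) λ { refl → t∉D s∈D }) t∉D
          = r , 1≤r , m<n⇒m<1+n r<s , r∉D , run'
    where
    run' : ∀ y → r < y → y < suc s → (y , c) ∈ D
    run' y r<y y<1+s with y ≟ s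
    ... | yes refl = s∈D
    ... | no y≢s = run y r<y (≤∧≢⇒< (≤-pred y<1+s) y≢s)

-- The offset k is 1 between the landing row and the starting row of a move, and 0 elsewhere.
N-step : ∀ {D E c} k {x} → ((suc x , c) ∈ D) ⇔ ((suc x , c) ∈ E) →
  N E c x ≡ k + N D c x → N E c (suc x) ≡ k + N D c (suc x)
N-step {D} {E} {c} k {x} same eq with (suc x , c) ∈? D
... | yes x∈D = trans (N-yes E c (to same x∈D))
      (trans (cong suc eq) (trans (sym (+-suc k _)) (cong (k +_) (sym (N-yes D c x∈D)))))
... | no x∉D = trans (N-no E c (x∉D ∘ from same)) (trans eq (cong (k +_) (sym (N-no D c x∉D))))

N-agree : ∀ {D E c} x → (∀ y → y ≤ x → ((y , c) ∈ D) ⇔ ((y , c) ∈ E)) → N E c x ≡ N D c x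
N-agree zero same = refl
N-agree (suc x) same = N-step 0 (same _ ≤-refl) (N-agree x (λ y y≤x → same y (m≤n⇒m≤1+n y≤x)))

row≢ : ∀ {r r' c c' : ℕ} → r ≢ r' → (r , c) ≢ (r' , c')
row≢ r≢r' refl = r≢r' refl

col≢ : ∀ {r r' c c' : ℕ} → c ≢ c' → (r , c) ≢ (r' , c')
col≢ c≢c' refl = c≢c' refl

module _ {r r' c D E} (rc∈D : (r , c) ∈ D) (1≤r' : 1 ≤ r') (r'<r : r' < r) (r'c∉D : (r' , c) ∉ D)
         (mv : Moved (r , c) (r' , c) D E) where

  N-moved-other : ∀ {c'} x → c' ≢ c → N E c' x ≡ N D c' x
  N-moved-other x c'≢c = N-agree x (λ y _ → moved-agree mv (col≢ c'≢c) (col≢ c'≢c))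

  N-moved-below : ∀ {x} → x < r' → N E c x ≡ N D c x
  N-moved-below x<r' = N-agree _ (λ y y≤x →
    moved-agree mv (row≢ (<⇒≢ (≤-<-trans y≤x (<-trans x<r' r'<r)))) (row≢ (<⇒≢ (≤-<-trans y≤x x<r'))))

  N-moved-mid : ∀ {x} → r' ≤ x → x < r → N E c x ≡ suc (N D c x)
  N-moved-mid {zero} r'≤x _ = contradiction (≤-trans 1≤r' r'≤x) λ ()
  N-moved-mid {suc x} r'≤x x<r with r' ≟ suc x
  ... | yes refl = trans (N-yes E c (moved-new mv))
          (cong suc (trans (N-moved-below ≤-refl) (sym (N-no D c r'c∉D))))
  ... | no r'≢x = N-step 1 (moved-agree mv (row≢ (<⇒≢ x<r)) (row≢ (≢-sym r'≢x)))
          (N-moved-mid (≤-pred (≤∧≢⇒< r'≤x r'≢x)) (<⇒≤ x<r))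

  N-moved-above : ∀ {x} → r ≤ x → N E c x ≡ N D c x
  N-moved-above {zero} r≤x = contradiction (≤-trans r'<r r≤x) λ ()
  N-moved-above {suc x} r≤x with r ≟ suc x
  ... | yes refl = trans (N-no E c (moved-gone mv (row≢ (≢-sym (<⇒≢ r'<r)))))
          (trans (N-moved-mid (≤-pred r'<r) ≤-refl) (sym (N-yes D c rc∈D)))
  ... | no r≢x = N-step 0 (moved-agree mv (row≢ (≢-sym r≢x)) (row≢ (≢-sym (<⇒≢ (<-≤-trans r'<r r≤x)))))
          (N-moved-above (≤-pred (≤∧≢⇒< r≤x r≢x)))

  N-moved-≥ : ∀ c' x → N D c' x ≤ N E c' x
  N-moved-≥ c' x with c' ≟ c
  ... | no c'≢c = ≤-reflexive (sym (N-moved-other x c'≢c))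
  ... | yes refl with x <? r' | x <? r
  ...   | yes x<r' | _ = ≤-reflexive (sym (N-moved-below x<r'))
  ...   | no x≮r' | yes x<r = ≤-trans (n≤1+n _) (≤-reflexive (sym (N-moved-mid (≮⇒≥ x≮r') x<r)))
  ...   | no _ | no x≮r = ≤-reflexive (sym (N-moved-above (≮⇒≥ x≮r)))

-- Rankedness without a pattern

N-cancel-< : ∀ D c {x y} → N D c x < N D c y → x < y
N-cancel-< D c {x} {y} Nx<Ny = ≰⇒> λ y≤x → <⇒≱ Nx<Ny (N-mono D c y≤x)

northeast : ∀ {D r₁ c₁ r₂ c₂} → Northeast D → (r₁ , c₁) ∈ D → (r₂ , c₂) ∈ D →
  r₂ ≤ r₁ → c₁ ≤ c₂ → (r₁ , c₂) ∈ D
northeast {D} ne x∈D y∈D r₂≤r₁ c₁≤c₂ =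
  subst (_∈ D) (cong₂ _,_ (m≥n⇒m⊔n≡m r₂≤r₁) (m≤n⇒m⊔n≡n c₁≤c₂)) (ne _ _ _ _ x∈D y∈D)

-- If the A-th cell of column c and the B-th cell of column d start in the same
-- row, this says that for all j the (A+j)-th cell of column c never lies below
-- the (B+j)-th cell of column d.
Dom : Diagram → ℕ → ℕ → ℕ → ℕ → Set
Dom D c d A B = ∀ x → A ≤ N D c x → N D c x + B ≤ N D d x + A

-- Above row a + 1, the northeast property gives for each cell of column c a cell of column d in the
-- same row, so column d gains at least as many cells.
Dom-northeast : ∀ {D a c d} → Northeast D → c < d → (suc a , c) ∈ D → (suc a , d) ∈ D →
  Dom D c d (N D c (suc a)) (N D d (suc a))
Dom-northeast {D} {a} {c} {d} ne c<d ac∈D ad∈D x A≤N =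
  subst (λ x → N D c x + N D d (suc a) ≤ N D d x + N D c (suc a)) (m∸n+n≡m a<x) (go (x ∸ suc a))
  where
  a<x : a < x
  a<x = N-cancel-< D c (subst (_≤ N D c x) (N-yes D c ac∈D) A≤N)
  go : ∀ k → N D c (k + suc a) + N D d (suc a) ≤ N D d (k + suc a) + N D c (suc a)
  go zero = ≤-reflexive (+-comm (N D c (suc a)) _)
  go (suc k) with (suc (k + suc a) , c) ∈? D
  ... | yes p rewrite N-yes D c p | N-yes D d (northeast ne p ad∈D (m≤n+m (suc a) (suc k)) (<⇒≤ c<d)) =
          s≤s (go k)
  ... | no p rewrite N-no D c p = ≤-trans (go k) (+-monoˡ-≤ _ (N≤N-suc D d (k + suc a)))

N-cong : ∀ {D E} → D ≈D E → ∀ c x → N E c x ≡ N D c x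
N-cong D≈E c x = N-agree x (λ y _ → D≈E (y , c))

-- A move in another column leaves column c alone and lowers no count of column d. A move in column
-- c raises its count by one from the landing row up to just below row r; there the old inequality
-- at row r implies the new one.
Dom-KMove : ∀ {D E c d A B} → c < d → KMove D E → Dom D c d A B → Dom E c d A B
Dom-KMove {D} {E} {c} {d} {A} {B} c<d
  (r , b , r' , rb∈D , right , 1≤r' , r'<r , r'b∉D , run , mv) dom x A≤N with c ≟ b
... | no c≢b rewrite N-moved-other rb∈D 1≤r' r'<r r'b∉D mv x c≢b =
        ≤-trans (dom x A≤N) (+-monoˡ-≤ A (N-moved-≥ rb∈D 1≤r' r'<r r'b∉D mv d x))
... | yes refl rewrite N-moved-other rb∈D 1≤r' r'<r r'b∉D mv x (≢-sym (<⇒≢ c<d))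
      with x <? r' | x <? r
...   | yes x<r' | _ rewrite N-moved-below rb∈D 1≤r' r'<r r'b∉D mv x<r' = dom x A≤N
...   | no _ | no x≮r rewrite N-moved-above rb∈D 1≤r' r'<r r'b∉D mv (≮⇒≥ x≮r) = dom x A≤N
...   | no x≮r' | yes x<r rewrite N-moved-mid rb∈D 1≤r' r'<r r'b∉D mv (≮⇒≥ x≮r') x<r =
        -- The k + 1 rows from x + 1 to r are all occupied in column c, whereas column d misses row
        -- r because the moved cell is the last of its row.
        +-cancelˡ-≤ k _ _ (begin
          k + (suc (N D c x) + B)    ≡⟨ +-assoc k (suc (N D c x)) B ⟨
          k + suc (N D c x) + B      ≡⟨ cong (_+ B) Nr ⟨
          N D c r + B                ≤⟨ dom r A≤Nr ⟩
          N D d r + A                ≤⟨ +-monoˡ-≤ A Ndr ⟩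
          k + N D d x + A            ≡⟨ +-assoc k (N D d x) A ⟩
          k + (N D d x + A)          ∎)
  where
  open ≤-Reasoning
  k : ℕ
  k = r ∸ suc x
  r≡ : suc k + x ≡ r
  r≡ = trans (sym (+-suc k x)) (m∸n+n≡m x<r)
  inRun : ∀ y → x < y → y ≤ suc k + x → (y , c) ∈ D
  inRun y x<y y≤ with y ≟ r
  ... | yes refl = rb∈D
  ... | no y≢r = run y (≤-<-trans (≮⇒≥ x≮r') x<y) (≤∧≢⇒< (subst (y ≤_) r≡ y≤) y≢r)
  Nr : N D c r ≡ k + suc (N D c x)
  Nr = trans (cong (N D c) (sym r≡)) (trans (N-run D c (suc k) x inRun) (sym (+-suc k _)))
  A≤Nr : A ≤ N D c r
  A≤Nr = ≤-trans A≤N (≤-trans (m≤n+m _ k) (≤-reflexive (sym Nr)))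
  Ndr : N D d r ≤ k + N D d x
  Ndr = subst (λ z → N D d z ≤ k + N D d x) r≡
    (≤-trans (≤-reflexive (N-no D d λ p → <⇒≱ c<d (right d (subst (λ z → (z , d) ∈ D) r≡ p))))
      (N-lip D d k x))

-- Invariants of the diagrams reachable from D₀: cells only come down, no column gains cells, and
-- `Dom` persists.
record Below (D₀ D : Diagram) : Set where
  field
    lower : ∀ c x → N D₀ c x ≤ N D c x
    upper : ∀ c x → ∃[ M ] N D c x ≤ N D₀ c M
    dom   : ∀ {c d A B} → c < d → Dom D₀ c d A B → Dom D c d A B

Below-KMove : ∀ {D₀ D E} → KMove D E → Below D₀ D → Below D₀ E
Below-KMove {D₀} {D} {E} m@(r , b , r' , rb∈D , _ , 1≤r' , r'<r , r'b∉D , _ , mv) below = record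
  { lower = λ c x → ≤-trans (lower c x) (N-moved-≥ rb∈D 1≤r' r'<r r'b∉D mv c x)
  ; upper = upper'
  ; dom = λ c<d d₀ → Dom-KMove c<d m (dom c<d d₀)
  }
  where
  open Below below
  upper' : ∀ c x → ∃[ M ] N E c x ≤ N D₀ c M
  -- The move takes place in rows up to r, so the counts at row `r ⊔ x` are unchanged and bound
  -- those at row x.
  upper' c x with c ≟ b | upper c (r ⊔ x)
  ... | yes refl | M , le = M , ≤-trans (N-mono E c (m≤n⊔m r x))
          (≤-trans (≤-reflexive (N-moved-above rb∈D 1≤r' r'<r r'b∉D mv (m≤m⊔n r x))) le)
  ... | no c≢b | M , le = M , ≤-trans (N-mono E c (m≤n⊔m r x))
          (≤-trans (≤-reflexive (N-moved-other rb∈D 1≤r' r'<r r'b∉D mv (r ⊔ x) c≢b)) le)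

Dom-≈ : ∀ {D E c d A B} → D ≈D E → Dom D c d A B → Dom E c d A B
Dom-≈ {c = c} {d} D≈E dom x A≤N rewrite N-cong D≈E c x | N-cong D≈E d x = dom x A≤N

Below-≈ : ∀ {D₀ D E} → D ≈D E → Below D₀ D → Below D₀ E
Below-≈ D≈E below = record
  { lower = λ c x → subst (_ ≤_) (sym (N-cong D≈E c x)) (lower c x)
  ; upper = λ c x → subst (λ n → ∃[ M ] n ≤ N _ c M) (sym (N-cong D≈E c x)) (upper c x)
  ; dom = λ c<d d₀ → Dom-≈ D≈E (dom c<d d₀)
  }
  where open Below below

Below-⟶* : ∀ {D₀ D E} → D ⟶* E → Below D₀ D → Below D₀ E
Below-⟶* (done D≈E) below = Below-≈ D≈E below
Below-⟶* (step m s) below = Below-⟶* s (Below-KMove m below)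

Below-InP : ∀ {D₀ D} → InP D₀ D → Below D₀ D
Below-InP s = Below-⟶* s record
  { lower = λ _ _ → ≤-refl ; upper = λ _ x → x , ≤-refl ; dom = λ _ d₀ → d₀ }

-- The pattern consists of the cells of D₀ that have, within their columns, the
-- same index as (s , c), (s + 1 , c) and (s , d) have in D.
blocked-pattern : ∀ {D₀ D s c d t} → Northeast D₀ → Below D₀ D →
  (s , c) ∈ D → (suc s , c) ∈ D → (s , d) ∈ D → c < d →
  (∀ c' → (suc s , c') ∈ D → c' ≤ c) →
  1 ≤ t → t < s → (t , c) ∉ D → Pattern D₀
blocked-pattern {D₀} {D} {suc s} {c} {d} {t} ne below x∈D y∈D z∈D c<d right 1≤t t<s t∉D
  with M , NM ← Below.upper below c (suc (suc s))
  with M' , NM' ← Below.upper below d (suc s)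
  with a₁ , x₁∈ , _ , Na₁ ← N-find D₀ c (N D c s) M
         (<-≤-trans (≤-trans (≤-reflexive (sym (N-yes D c x∈D))) (N≤N-suc D c (suc s))) NM)
  with a₂ , x₂∈ , _ , Na₂ ← N-find D₀ c (suc (N D c s)) M
         (≤-trans (≤-reflexive (sym (trans (N-yes D c y∈D) (cong suc (N-yes D c x∈D))))) NM)
  with a₃ , x₃∈ , _ , Na₃ ← N-find D₀ d (N D d s) M'
         (≤-trans (≤-reflexive (sym (N-yes D d z∈D))) NM')
  = suc a₁ , c , suc a₂ , suc a₃ , d , x₁∈ , x₂∈ , x₃∈ , s≤s a₁<a₂ , r₂≤r₃ , c<d , holes , counts
  where
  open Below below
  N₁ : N D₀ c (suc a₁) ≡ suc (N D c s)
  N₁ = trans (N-yes D₀ c x₁∈) (cong suc Na₁)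
  N₂ : N D₀ c (suc a₂) ≡ N D c (suc (suc s))
  N₂ = trans (N-yes D₀ c x₂∈) (trans (cong suc Na₂)
    (sym (trans (N-yes D c y∈D) (cong suc (N-yes D c x∈D)))))
  N₃ : N D₀ d (suc a₃) ≡ N D d (suc s)
  N₃ = trans (N-yes D₀ d x₃∈) (trans (cong suc Na₃) (sym (N-yes D d z∈D)))
  a₁<a₂ : a₁ < a₂
  a₁<a₂ = N-cancel-< D₀ c (≤-reflexive (trans (cong suc Na₁) (sym Na₂)))
  -- Cells only come down, so x₁ starts at or above row s + 1, its row in D.
  s<r₁ : s < suc a₁
  s<r₁ = N-cancel-< D₀ c (≤-<-trans (lower c s) (≤-reflexive (sym N₁)))
  above-empty : ∀ {c'} → c < c' → (suc (suc s) , c') ∉ D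
  above-empty c<c' p = <⇒≱ c<c' (right _ p)
  -- In D the cell x₂ has come down to row s + 2, and by `dom` the cell of column c' starting beside
  -- it lies no higher. Row s + 2 has no cell to the right of column c, so that cell lies in row s +
  -- 1 or below.
  transfer : ∀ {c'} → c < c' → (suc a₂ , c') ∈ D₀ → N D₀ c' (suc a₂) ≤ N D c' (suc s)
  transfer {c'} c<c' p = +-cancelˡ-≤ (N D c (suc (suc s))) _ _ (begin
    N D c (suc (suc s)) + N D₀ c' (suc a₂)
      ≤⟨ dom c<c' (Dom-northeast ne c<c' x₂∈ p) (suc (suc s)) (≤-reflexive N₂) ⟩
    N D c' (suc (suc s)) + N D₀ c (suc a₂) ≡⟨ cong₂ _+_ (N-no D c' (above-empty c<c')) N₂ ⟩
    N D c' (suc s) + N D c (suc (suc s))   ≡⟨ +-comm (N D c' (suc s)) _ ⟩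
    N D c (suc (suc s)) + N D c' (suc s)   ∎)
    where open ≤-Reasoning
  -- Otherwise column d has a cell in row r₂, above x₃. By `transfer` it is in row s + 1 or below in
  -- D, yet x₃ already occupies row s + 1.
  r₂≤r₃ : suc a₂ ≤ suc a₃
  r₂≤r₃ = ≮⇒≥ λ r₃<r₂ →
    let p = northeast ne x₂∈ x₃∈ (<⇒≤ r₃<r₂) (<⇒≤ c<d) in
    <-irrefl refl (begin-strict
      N D d (suc s)      ≡⟨ N₃ ⟨
      N D₀ d (suc a₃)    ≤⟨ N-mono D₀ d (≤-pred r₃<r₂) ⟩
      N D₀ d a₂          <⟨ ≤-reflexive (sym (N-yes D₀ d p)) ⟩
      N D₀ d (suc a₂)    ≤⟨ transfer c<d p ⟩
      N D d (suc s)      ∎)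
    where open ≤-Reasoning
  0<a₁ : 0 < a₁
  0<a₁ = ≤-trans (≤-trans 1≤t (≤-pred t<s)) (≤-pred s<r₁)
  holes : ∀ c' → c ≤ c' → c' < d → Σ ℕ λ r → (1 ≤ r) × (r < suc a₁) × ((r , c') ∉ D₀)
  holes c' c≤c' _ with hole? D₀ c' a₁
  ... | inj₁ (r , 1≤r , r≤a₁ , r∉) = r , 1≤r , s≤s r≤a₁ , r∉
  -- For c' = c, at least s cells would lie below x₁, but the hole in row t leaves fewer in D.
  -- Otherwise column c' also has cells in rows r₁ and r₂, more than `transfer` allows.
  ... | inj₂ full with c' ≟ c
  ...   | yes refl = contradiction (N-hole D c 1≤t (≤-pred t<s) t∉D)
            (≤⇒≯ (≤-trans (≤-pred s<r₁) (≤-reflexive (trans (sym full) Na₁))))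
  ...   | no c'≢c with b , p , b<a₁ , _ ← N-find D₀ c' 0 a₁ (subst (0 <_) (sym full) 0<a₁) =
            contradiction (≤-trans (transfer c<c' (col' x₂∈ (<-trans b<a₁ a₁<a₂))) (N≤ D c' (suc s)))
              (<⇒≱ (begin-strict
                suc s             ≤⟨ s<r₁ ⟩
                suc a₁            ≡⟨ cong suc full ⟨
                suc (N D₀ c' a₁)  ≡⟨ N-yes D₀ c' (col' x₁∈ b<a₁) ⟨
                N D₀ c' (suc a₁)  ≤⟨ N-mono D₀ c' a₁<a₂ ⟩
                N D₀ c' a₂        <⟨ ≤-reflexive (sym (N-yes D₀ c' (col' x₂∈ (<-trans b<a₁ a₁<a₂)))) ⟩
                N D₀ c' (suc a₂)  ∎))
    where
    open ≤-Reasoning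
    c<c' : c < c'
    c<c' = ≤∧≢⇒< c≤c' (≢-sym c'≢c)
    col' : ∀ {a} → (suc a , c) ∈ D₀ → b < a → (suc a , c') ∈ D₀
    col' q b<a = northeast ne q p (s≤s (<⇒≤ b<a)) c≤c'
  counts : ∀ c' → d ≤ c' → countBelow D₀ (suc a₃) c' < suc a₁
  counts c' d≤c' with c' ≟ d
  ... | yes refl = ≤-<-trans (≤-trans (≤-reflexive Na₃) (N≤ D d s)) s<r₁
  -- A cell of column c' below r₃ forces one in row r₃. Comparing that one with x₃ by `dom` leaves
  -- at most s + 1 cells up to row r₃, hence fewer than r₁ below it.
  ... | no c'≢d = ≰⇒> λ r₁≤N →
          let b , p , b<a₃ , _ = N-find D₀ c' 0 a₃ (≤-trans (s≤s z≤n) r₁≤N)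
              q = northeast ne x₃∈ p (s≤s (<⇒≤ b<a₃)) d≤c'
              d<c' = ≤∧≢⇒< d≤c' (≢-sym c'≢d)
          in <⇒≱ s<r₁ (≤-pred (begin-strict
            suc a₁            ≤⟨ r₁≤N ⟩
            N D₀ c' a₃        <⟨ ≤-reflexive (sym (N-yes D₀ c' q)) ⟩
            N D₀ c' (suc a₃)  ≤⟨ +-cancelˡ-≤ (N D d (suc s)) _ _ (begin
              N D d (suc s) + N D₀ c' (suc a₃)
                ≤⟨ dom d<c' (Dom-northeast ne d<c' x₃∈ q) (suc s) (≤-reflexive N₃) ⟩
              N D c' (suc s) + N D₀ d (suc a₃) ≡⟨ cong (N D c' (suc s) +_) N₃ ⟩
              N D c' (suc s) + N D d (suc s)   ≡⟨ +-comm (N D c' (suc s)) _ ⟩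
              N D d (suc s) + N D c' (suc s)   ∎) ⟩
            N D c' (suc s)    ≤⟨ N≤ D c' (suc s) ⟩
            suc s             ∎))
    where open ≤-Reasoning

-- The first diagram of a longer sequence of moves would lie strictly between.
covers-KMove : ∀ {x y} → Covers y x → KMove y x
covers-KMove ((z , m , done z≈x) , _) = KMove-respʳ m z≈x
covers-KMove ((z , m , step m' s) , noBetween) =
  contradiction (z , (z , m , done ≈D-refl) , (_ , m' , s)) noBetween

-- Without a pattern the cell just below a jumping cell is itself free to move,
-- so a jump by at least two rows splits into two moves.
covers-unit : ∀ {D₀ x y} → Northeast D₀ → ¬ Pattern D₀ → InP D₀ y → Covers y x →
  rowSum y ≡ suc (rowSum x)
covers-unit {D₀} {x} {y} ne noPattern y∈P cov
  with suc s , c , r' , p , right , 1≤r' , r'<r , r'∉ , run , mv ← covers-KMove cov with r' ≟ s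
... | yes refl = sym (+-cancelˡ-≡ s _ _ (trans (+-suc s _) (rowSum-moved p r'∉ mv)))
... | no r'≢s = contradiction (z , (z , first , done ≈D-refl) , (x , second , done ≈D-refl)) (proj₂ cov)
  where
  r'<s : r' < s
  r'<s = ≤∧≢⇒< (≤-pred r'<r) r'≢s
  s∈y : (s , c) ∈ y
  s∈y = run s r'<s ≤-refl
  -- The lower cell jumps to r' first; the top cell then drops into the vacated row s, which again
  -- gives x.
  z : Diagram
  z = move (s , c) (r' , c) y
  mz : Moved (s , c) (r' , c) y z
  mz = move-moved (s , c) (r' , c) y
  first : KMove y z
  first = s , c , r' , s∈y ,
    (λ c' q → ≮⇒≥ λ c<c' → noPattern (blocked-pattern ne (Below-InP y∈P) s∈y p q c<c' right 1≤r' r'<s r'∉)) ,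
    1≤r' , r'<s , r'∉ , (λ y r'<y y<s → run y r'<y (m<n⇒m<1+n y<s)) , mz
  top≢s : (suc s , c) ≢ (s , c)
  top≢s = row≢ 1+n≢n
  top≢r' : ∀ {c'} → (suc s , c') ≢ (r' , c)
  top≢r' = row≢ (≢-sym (<⇒≢ r'<r))
  s≢r' : (s , c) ≢ (r' , c)
  s≢r' = row≢ (≢-sym r'≢s)
  second : KMove z x
  second = suc s , c , s , moved-keep mz p top≢s , (λ c' q → right c' (moved-old mz q top≢r')) ,
    ≤-trans 1≤r' (<⇒≤ r'<s) , ≤-refl , moved-gone mz s≢r' ,
    (λ y s<y y<s → contradiction (≤-pred y<s) (<⇒≱ s<y)) , mv'
    where
    mv' : Moved (suc s , c) (s , c) z x
    mv' w = mk⇔ fwd bwd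
      where
      fwd : w ∈ x → (w ∈ z × w ≢ (suc s , c)) ⊎ w ≡ (s , c)
      fwd w∈x with w ≟C (s , c)
      ... | yes w≡s = inj₂ w≡s
      ... | no w≢s with to (mv w) w∈x
      ...   | inj₁ (w∈y , w≢top) = inj₁ (moved-keep mz w∈y w≢s , w≢top)
      ...   | inj₂ refl = inj₁ (moved-new mz , ≢-sym top≢r')
      bwd : (w ∈ z × w ≢ (suc s , c)) ⊎ w ≡ (s , c) → w ∈ x
      bwd (inj₂ refl) = moved-keep mv s∈y (≢-sym top≢s)
      bwd (inj₁ (w∈z , w≢top)) with to (mz w) w∈z
      ... | inj₁ (w∈y , _) = moved-keep mv w∈y w≢top
      ... | inj₂ refl = moved-new mv

noPattern⇒ranked : ∀ {D₀} → Northeast D₀ → ¬ Pattern D₀ → Ranked D₀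
noPattern⇒ranked ne noPattern =
  rowSum , (λ _ _ _ _ → rowSum-cong) , (λ _ _ _ _ → rowSum-⟶+) , λ _ _ _ → covers-unit ne noPattern

-- Non-rankedness from a pattern

KMove-respˡ : ∀ {D D' E} → D ≈D D' → KMove D' E → KMove D E
KMove-respˡ D≈D' (r , c , r' , p , right , 1≤r' , r'<r , r'∉ , run , mv) =
  r , c , r' , from (D≈D' _) p , (λ c' q → right c' (to (D≈D' _) q)) , 1≤r' , r'<r ,
  (λ q → r'∉ (to (D≈D' _) q)) , (λ y r'<y y<r → from (D≈D' _) (run y r'<y y<r)) ,
  λ z → ⇔.trans (mv z) (mk⇔
    (λ { (inj₁ (z∈ , z≢)) → inj₁ (from (D≈D' z) z∈ , z≢) ; (inj₂ z≡) → inj₂ z≡ })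
    (λ { (inj₁ (z∈ , z≢)) → inj₁ (to (D≈D' z) z∈ , z≢) ; (inj₂ z≡) → inj₂ z≡ }))

⟶*-snoc : ∀ {D E F} → D ⟶* E → KMove E F → D ⟶* F
⟶*-snoc (done D≈E) m = step (KMove-respˡ D≈E m) (done ≈D-refl)
⟶*-snoc (step m' s) m = step m' (⟶*-snoc s m)

-- Every move lowers the row sum, so no move was made.
⟶*-rowSum-≈ : ∀ {D E} → D ⟶* E → rowSum D ≤ rowSum E → D ≈D E
⟶*-rowSum-≈ (done D≈E) _ = D≈E
⟶*-rowSum-≈ (step m s) le = contradiction (rowSum-⟶+ (_ , m , s)) (≤⇒≯ le)

UMove : Diagram → Diagram → Set
UMove D E = Σ ℕ λ r → Σ ℕ λ c →
    ((suc r , c) ∈ D) × (∀ c' → (suc r , c') ∈ D → c' ≤ c)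
  × (1 ≤ r) × ((r , c) ∉ D) × Moved (suc r , c) (r , c) D E

UMove⇒KMove : ∀ {D E} → UMove D E → KMove D E
UMove⇒KMove (r , c , p , right , 1≤r , r∉ , mv) =
  suc r , c , r , p , right , 1≤r , ≤-refl , r∉ ,
  (λ y r<y y<1+r → contradiction (≤-pred y<1+r) (<⇒≱ r<y)) , mv

rowSum-UMove : ∀ {D E} → UMove D E → rowSum D ≡ suc (rowSum E)
rowSum-UMove (r , c , p , _ , _ , r∉ , mv) =
  sym (+-cancelˡ-≡ r _ _ (trans (+-suc r _) (rowSum-moved p r∉ mv)))

-- The row sum drops by the number of rows the cell falls.
KMove-UMove : ∀ {D E} → KMove D E → rowSum D ≤ suc (rowSum E) → UMove D E
KMove-UMove {D} {E} (suc r , c , r' , p , right , 1≤r' , r'<r , r'∉ , run , mv) le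
  = unit (≤-antisym (≤-pred r'<r) r≤r')
  where
  open ≤-Reasoning
  unit : r' ≡ r → UMove D E
  unit refl = r , c , p , right , 1≤r' , r'∉ , mv
  r≤r' : r ≤ r'
  r≤r' = +-cancelʳ-≤ (suc (rowSum E)) r r' (begin
    r + suc (rowSum E)   ≡⟨ +-suc r _ ⟩
    suc r + rowSum E     ≡⟨ rowSum-moved p r'∉ mv ⟩
    r' + rowSum D        ≤⟨ +-monoʳ-≤ r' le ⟩
    r' + suc (rowSum E)  ∎)

-- A diagram strictly between would make the row sum drop by at least two.
UMove⇒Covers : ∀ {D E} → UMove D E → Covers D E
UMove⇒Covers {D} {E} u = (E , UMove⇒KMove u , done ≈D-refl) , λ (z , D>z , z>E) →
  <⇒≱ (≤-<-trans (rowSum-⟶+ z>E) (rowSum-⟶+ D>z)) (≤-reflexive (rowSum-UMove u))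

-- A jump over a cell that is not the last one in its row is a cover although
-- the row sum drops by two: an intermediate diagram would be one unit move away
-- from both ends, and the skipped cell would have to move.
jump-Covers : ∀ {D E p c d} → (suc (suc p) , c) ∈ D → (∀ c' → (suc (suc p) , c') ∈ D → c' ≤ c) →
  (suc p , c) ∈ D → (suc p , d) ∈ D → c < d → 1 ≤ p → (p , c) ∉ D →
  Moved (suc (suc p) , c) (p , c) D E → Covers D E × rowSum D ≡ suc (suc (rowSum E))
jump-Covers {D} {E} {p} {c} {d} top right mid block c<d 1≤p p∉D mv =
  ((E , jump , done ≈D-refl) , noBetween) , drop
  where
  drop : rowSum D ≡ suc (suc (rowSum E))
  drop = sym (+-cancelˡ-≡ p _ _ (trans (+-suc p _) (trans (cong suc (+-suc p _)) (rowSum-moved top p∉D mv))))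
  jump : KMove D E
  jump = suc (suc p) , c , p , top , right , 1≤p , n≤1+n _ , p∉D , run , mv
    where
    run : ∀ y → p < y → y < suc (suc p) → (y , c) ∈ D
    run y p<y y<2+p with refl ← ≤-antisym p<y (≤-pred y<2+p) = mid
  absurd : ∀ {z} → UMove D z → UMove z E → ⊥
  absurd {z} (a , b , _ , right₁ , _ , _ , mv₁) (a₂ , b₂ , _ , right₂ , _ , _ , mv₂)
    -- The new cell (p , c) is the target of one of the two unit moves, from (p + 1 , c). At that
    -- moment (p + 1 , d), a cell of both D and E, lies to its right.
    with to (mv₂ (p , c)) (moved-new mv)
  ... | inj₁ (p∈z , _) with to (mv₁ (p , c)) p∈z
  ...   | inj₁ (p∈D , _) = p∉D p∈D
  ...   | inj₂ refl = <⇒≱ c<d (right₁ d block)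
  absurd {z} (a , b , _ , right₁ , _ , _ , mv₁) (a₂ , b₂ , _ , right₂ , _ , _ , mv₂) | inj₂ refl
    = block∉z (moved-old mv₂ (moved-keep mv block (row≢ (≢-sym 1+n≢n))) (row≢ 1+n≢n))
    where
    block∉z : (suc p , d) ∉ z
    block∉z q = <⇒≱ c<d (right₂ d q)
  noBetween : ¬ (Σ Diagram λ z → (D ⟶+ z) × (z ⟶+ E))
  noBetween (z , (z₁ , m₁ , s₁) , (w , m₂ , s₂)) = absurd
    (KMove-UMove (KMove-respʳ m₁ (⟶*-rowSum-≈ s₁ z₁≤z)) D≤z)
    (KMove-UMove (KMove-respʳ m₂ (⟶*-rowSum-≈ s₂ w≤E)) z≤E)
    where
    z₁≤1+E : rowSum z₁ ≤ suc (rowSum E)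
    z₁≤1+E = ≤-pred (subst (rowSum z₁ <_) drop (rowSum-KMove m₁))
    z>E : rowSum E < rowSum z
    z>E = rowSum-⟶+ (w , m₂ , s₂)
    z≤E : rowSum z ≤ suc (rowSum E)
    z≤E = ≤-trans (rowSum-⟶* s₁) z₁≤1+E
    z₁≤z : rowSum z₁ ≤ rowSum z
    z₁≤z = ≤-trans z₁≤1+E z>E
    w≤E : rowSum w ≤ rowSum E
    w≤E = ≤-pred (≤-trans (rowSum-KMove m₂) z≤E)
    D≤z : rowSum D ≤ suc (rowSum z)
    D≤z = ≤-trans (≤-reflexive drop) (s≤s z>E)

-- Searching a diagram and iterating moves

search : ∀ {P : Cell → Set} → (∀ x → Dec (P x)) → ∀ D →
  (∃[ x ] x ∈ D × P x) ⊎ (∀ x → x ∈ D → ¬ P x)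
search P? D with any? P? D
... | yes some = inj₁ (find some)
... | no none = inj₂ λ x x∈D px → none (lose x∈D px)

-- Fuel for recursions moving to the right: passing from column a to b > a uses up one unit of n.
≤-shift : ∀ n {a b c} → c ≤ suc n + a → a < b → c ≤ n + b
≤-shift n {a} c≤ a<b = ≤-trans c≤ (≤-trans (≤-reflexive (sym (+-suc n a))) (+-monoʳ-≤ n a<b))

rightmost : ∀ {D s c} → (s , c) ∈ D →
  ∃[ c' ] c ≤ c' × (s , c') ∈ D × (∀ e → (s , e) ∈ D → e ≤ c')
rightmost {D} {s} {c} p = go (suc bound) c p (m≤m+n _ c)
  where
  bound : ℕ
  bound = max 0 (map proj₂ D)
  go : ∀ n c → (s , c) ∈ D → bound < n + c →
    ∃[ c' ] c ≤ c' × (s , c') ∈ D × (∀ e → (s , e) ∈ D → e ≤ c')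
  go zero c p b<c = contradiction (All.lookup (xs≤max 0 (map proj₂ D)) (∈-map⁺ proj₂ p)) (<⇒≱ b<c)
  go (suc n) c p b<n+c with search (λ x → (proj₁ x ≟ s) ×-dec (c <? proj₂ x)) D
  ... | inj₂ none = c , ≤-refl , p , λ e q → ≮⇒≥ λ c<e → none _ q (refl , c<e)
  ... | inj₁ ((_ , e) , q , refl , c<e)
        with c' , e≤c' , r , right ← go n e q (≤-shift n b<n+c c<e)
        = c' , ≤-trans (<⇒≤ c<e) e≤c' , r , right

-- The row sum decreases at each round, so its successor is enough fuel.
exhaust : ∀ {Inv Done : Diagram → Set} →
  (∀ D → Inv D → Done D ⊎ (∃[ E ] rowSum E < rowSum D × Inv E)) →
  ∀ D → Inv D → ∃[ E ] Inv E × Done E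
exhaust {Inv} {Done} next D i = go (suc (rowSum D)) D ≤-refl i
  where
  go : ∀ n D → rowSum D < n → Inv D → ∃[ E ] Inv E × Done E
  go (suc n) D S<n i with next D i
  ... | inj₁ d = D , i , d
  ... | inj₂ (E , E<D , i') = go n E (<-≤-trans E<D (≤-pred S<n)) i'

moved-refl : ∀ x D → x ∈ D → Moved x x D D
moved-refl x D x∈D z = mk⇔ fwd λ { (inj₁ (z∈D , _)) → z∈D ; (inj₂ refl) → x∈D }
  where
  fwd : z ∈ D → (z ∈ D × z ≢ x) ⊎ z ≡ x
  fwd z∈D with z ≟C x
  ... | yes z≡x = inj₂ z≡x
  ... | no z≢x = inj₁ (z∈D , z≢x)

-- As y is not in D, the second replacement removes only the cell that the first one added.
moved-trans : ∀ {x y w D E F} → y ∉ D → Moved x y D E → Moved y w E F → Moved x w D F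
moved-trans {x} {y} {w} {D} {E} {F} y∉D mv mv' z = mk⇔ fwd bwd
  where
  fwd : z ∈ F → (z ∈ D × z ≢ x) ⊎ z ≡ w
  fwd z∈F with to (mv' z) z∈F
  ... | inj₂ z≡w = inj₂ z≡w
  ... | inj₁ (z∈E , z≢y) with to (mv z) z∈E
  ...   | inj₁ q = inj₁ q
  ...   | inj₂ z≡y = contradiction z≡y z≢y
  bwd : (z ∈ D × z ≢ x) ⊎ z ≡ w → z ∈ F
  bwd (inj₂ refl) = moved-new mv'
  bwd (inj₁ (z∈D , z≢x)) = moved-keep mv' (moved-keep mv z∈D z≢x) λ { refl → y∉D z∈D }

-- Lowering part of a row and clearing rows

Outside : ℕ → ℕ → ℕ → ℕ → ℕ → Set
Outside c₁ lo hi r c = c ≤ c₁ ⊎ r < lo ⊎ hi < r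

-- D with the part of row hi to the right of column c₁ lowered to row lo.
record Lowered (c₁ lo hi : ℕ) (D E : Diagram) : Set where
  field
    outside : ∀ {r c} → Outside c₁ lo hi r c → ((r , c) ∈ D) ⇔ ((r , c) ∈ E)
    gone    : ∀ {r c} → c₁ < c → lo < r → r ≤ hi → (r , c) ∉ E
    landed  : ∀ {c} → c₁ < c → ((hi , c) ∈ D) ⇔ ((lo , c) ∈ E)

-- To the right of column c₁, `Lowered` determines E from D: `landed` in row lo, `gone` in the rows
-- above it up to hi, `outside` elsewhere.
Lowered-agree : ∀ {c₁ lo hi D D' E E'} → Lowered c₁ lo hi D E → Lowered c₁ lo hi D' E' →
  (∀ {r c} → c₁ < c → ((r , c) ∈ D) ⇔ ((r , c) ∈ D')) →
  ∀ {r c} → c₁ < c → ((r , c) ∈ E) ⇔ ((r , c) ∈ E')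
Lowered-agree {c₁} {lo} {hi} L L' same {r} {c} c₁<c with <-cmp r lo
... | tri< r<lo _ _ = ⇔.trans (⇔.sym (L.outside (inj₂ (inj₁ r<lo))))
        (⇔.trans (same c₁<c) (L'.outside (inj₂ (inj₁ r<lo))))
  where module L = Lowered L ; module L' = Lowered L'
... | tri≈ _ refl _ = ⇔.trans (⇔.sym (L.landed c₁<c)) (⇔.trans (same c₁<c) (L'.landed c₁<c))
  where module L = Lowered L ; module L' = Lowered L'
... | tri> _ _ lo<r with r ≤? hi
...   | yes r≤hi = mk⇔ (λ q → contradiction q (L.gone c₁<c lo<r r≤hi))
                       (λ q → contradiction q (L'.gone c₁<c lo<r r≤hi))
  where module L = Lowered L ; module L' = Lowered L'
...   | no r≰hi = ⇔.trans (⇔.sym (L.outside (inj₂ (inj₂ (≰⇒> r≰hi)))))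
        (⇔.trans (same c₁<c) (L'.outside (inj₂ (inj₂ (≰⇒> r≰hi)))))
  where module L = Lowered L ; module L' = Lowered L'

-- A cell in row s ≥ r₁ with all of rows 1 , … , s - 1 below it occupied would
-- contradict N D c m < r₁, so as long as there is a cell to push, a move exists.
clear : ∀ {D₀ D} c₁ r₁ m → InP D₀ D → (∀ c → c₁ < c → N D c m < r₁) →
  ∃[ E ] InP D₀ E
    × (∀ {r c} → c ≤ c₁ ⊎ m < r → ((r , c) ∈ D) ⇔ ((r , c) ∈ E))
    × (∀ {r c} → c₁ < c → r₁ ≤ r → r ≤ m → (r , c) ∉ E)
clear {D₀} {D} c₁ r₁ m D∈P few =
  let E , (E∈P , same , _) , d = exhaust {Inv} {Done} next D (D∈P , (λ _ → ⇔.refl) , few)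
  in E , E∈P , same , d
  where
  Inv Done : Diagram → Set
  Inv E = InP D₀ E
    × (∀ {r c} → c ≤ c₁ ⊎ m < r → ((r , c) ∈ D) ⇔ ((r , c) ∈ E))
    × (∀ c → c₁ < c → N E c m < r₁)
  Done E = ∀ {r c} → c₁ < c → r₁ ≤ r → r ≤ m → (r , c) ∉ E
  next : ∀ E → Inv E → Done E ⊎ (∃[ F ] rowSum F < rowSum E × Inv F)
  next E (E∈P , same , few)
    with search (λ x → (c₁ <? proj₂ x) ×-dec ((r₁ ≤? proj₁ x) ×-dec (proj₁ x ≤? m))) E
  ... | inj₂ none = inj₁ λ c₁<c r₁≤r r≤m q → none _ q (c₁<c , r₁≤r , r≤m)
  ... | inj₁ ((s , c) , p , c₁<c , r₁≤s , s≤m) with b , c≤b , q , right ← rightmost p with hole? E b s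
  ...   | inj₂ full = contradiction (few b (<-≤-trans c₁<c c≤b))
            (≤⇒≯ (≤-trans r₁≤s (≤-trans (≤-reflexive (sym full)) (N-mono E b s≤m))))
  ...   | inj₁ (t , 1≤t , t≤s , t∉)
          with r' , 1≤r' , r'<s , r'∉ , run ← highestHole E b s 1≤t (≤∧≢⇒< t≤s λ { refl → t∉ q }) t∉
          = inj₂ (F , rowSum-KMove km , ⟶*-snoc E∈P km , same' , few')
    where
    F : Diagram
    F = move (s , b) (r' , b) E
    mv : Moved (s , b) (r' , b) E F
    mv = move-moved (s , b) (r' , b) E
    km : KMove E F
    km = s , b , r' , q , right , 1≤r' , r'<s , r'∉ , run , mv
    off : ∀ {r r'' c} → c ≤ c₁ ⊎ m < r → r'' ≤ m → (r , c) ≢ (r'' , b)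
    off (inj₁ c≤c₁) _ refl = <⇒≱ c₁<c (≤-trans c≤b c≤c₁)
    off (inj₂ m<r) r''≤m refl = <⇒≱ m<r r''≤m
    same' : ∀ {r c} → c ≤ c₁ ⊎ m < r → ((r , c) ∈ D) ⇔ ((r , c) ∈ F)
    same' o = ⇔.trans (same o) (moved-agree mv (off o s≤m) (off o (≤-trans (<⇒≤ r'<s) s≤m)))
    few' : ∀ e → c₁ < e → N F e m < r₁
    few' e c₁<e with e ≟ b
    ... | yes refl = subst (_< r₁) (sym (N-moved-above q 1≤r' r'<s r'∉ mv s≤m)) (few e c₁<e)
    ... | no e≢b = subst (_< r₁) (sym (N-moved-other q 1≤r' r'<s r'∉ mv m e≢b)) (few e c₁<e)

-- Rank functions along unit moves

module Rank {D₀} (ranked : Ranked D₀) where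

  ρ : Diagram → ℕ
  ρ = proj₁ ranked

  ρ-cong : ∀ x y → InP D₀ x → InP D₀ y → x ≈D y → ρ x ≡ ρ y
  ρ-cong = proj₁ (proj₂ ranked)

  ρ-covers : ∀ x y → InP D₀ x → InP D₀ y → Covers y x → ρ y ≡ suc (ρ x)
  ρ-covers = proj₂ (proj₂ (proj₂ ranked))

  -- The equation says, without subtraction, that ρ minus the row sum takes the same value on D and
  -- E.
  Tight : Diagram → Diagram → Set
  Tight D E = InP D₀ E × ρ D + rowSum E ≡ ρ E + rowSum D

  tight-refl : ∀ {D} → InP D₀ D → Tight D D
  tight-refl D∈P = D∈P , refl

  tight-trans : ∀ {D E F} → Tight D E → Tight E F → Tight D F
  tight-trans {D} {E} {F} (_ , eq) (F∈P , eq') = F∈P , +-cancelˡ-≡ (ρ E + rowSum E) _ _ (begin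
    (ρ E + rowSum E) + (ρ D + rowSum F)
      ≡⟨ solve 4 (λ a b c d → (a :+ b) :+ (c :+ d) := (c :+ b) :+ (a :+ d)) refl
           (ρ E) (rowSum E) (ρ D) (rowSum F) ⟩
    (ρ D + rowSum E) + (ρ E + rowSum F) ≡⟨ cong₂ _+_ eq eq' ⟩
    (ρ E + rowSum D) + (ρ F + rowSum E)
      ≡⟨ solve 4 (λ a b c d → (a :+ b) :+ (c :+ d) := (a :+ d) :+ (c :+ b)) refl
           (ρ E) (rowSum D) (ρ F) (rowSum E) ⟩
    (ρ E + rowSum E) + (ρ F + rowSum D) ∎)
    where
    open ≡-Reasoning
    open +-*-Solver

  tight-unit : ∀ {D E} → InP D₀ D → UMove D E → Tight D E
  tight-unit {D} {E} D∈P u = E∈P , (begin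
    ρ D + rowSum E       ≡⟨ cong (_+ rowSum E) (ρ-covers E D E∈P D∈P (UMove⇒Covers u)) ⟩
    suc (ρ E + rowSum E) ≡⟨ +-suc (ρ E) (rowSum E) ⟨
    ρ E + suc (rowSum E) ≡⟨ cong (ρ E +_) (rowSum-UMove u) ⟨
    ρ E + rowSum D       ∎)
    where
    open ≡-Reasoning
    E∈P : InP D₀ E
    E∈P = ⟶*-snoc D∈P (UMove⇒KMove u)

  abstract
    -- Rows lo to hi contain at most one cell of each column to the right of c₁, and unit moves
    -- preserve this, so the last cell of a row among them is never blocked until it reaches row lo.
    lower : ∀ {D} c₁ lo hi → InP D₀ D → 1 ≤ lo → lo ≤ hi →
      (∀ {r c} → c₁ < c → lo ≤ r → r < hi → (r , c) ∉ D) →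
      ∃[ E ] Tight D E × Lowered c₁ lo hi D E
    lower {D} c₁ lo hi D∈P 1≤lo lo≤hi empty = result
      where
      Here : ℕ → Set
      Here r = lo ≤ r × r ≤ hi
      Inv Done : Diagram → Set
      Inv E = Tight D E
        × (∀ {r c} → Outside c₁ lo hi r c → ((r , c) ∈ D) ⇔ ((r , c) ∈ E))
        × (∀ {c r r'} → c₁ < c → Here r → Here r' → (r , c) ∈ E → (r' , c) ∈ E → r ≡ r')
        × (∀ {c} → c₁ < c → ((hi , c) ∈ D) ⇔ (∃[ r ] Here r × (r , c) ∈ E))
      Done E = ∀ {r c} → c₁ < c → lo < r → r ≤ hi → (r , c) ∉ E
      atTop : ∀ {r c} → c₁ < c → Here r → (r , c) ∈ D → r ≡ hi
      atTop c₁<c (lo≤r , r≤hi) q = ≤-antisym r≤hi (≮⇒≥ λ r<hi → empty c₁<c lo≤r r<hi q)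
      start : Inv D
      start = tight-refl D∈P , (λ _ → ⇔.refl) ,
        (λ c₁<c h h' q q' → trans (atTop c₁<c h q) (sym (atTop c₁<c h' q'))) ,
        λ c₁<c → mk⇔ (λ q → hi , (lo≤hi , ≤-refl) , q)
          (λ (r , h , q) → subst (λ r → (r , _) ∈ D) (atTop c₁<c h q) q)
      next : ∀ E → Inv E → Done E ⊎ (∃[ F ] rowSum F < rowSum E × Inv F)
      next E (tight , out , uniq , ex)
        with search (λ x → (c₁ <? proj₂ x) ×-dec ((lo <? proj₁ x) ×-dec (proj₁ x ≤? hi))) E
      ... | inj₂ none = inj₁ λ c₁<c lo<r r≤hi q → none _ q (c₁<c , lo<r , r≤hi)
      ... | inj₁ ((suc s , c) , p , c₁<c , lo<s , s≤hi) with b , c≤b , q , right ← rightmost p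
            = inj₂ (F , rowSum-KMove (UMove⇒KMove u) , tight-trans tight (tight-unit (proj₁ tight) u) ,
                    out' , uniq' , λ c₁<e → mk⇔ (ex⇒ c₁<e) (ex⇐ c₁<e))
        where
        c₁<b : c₁ < b
        c₁<b = <-≤-trans c₁<c c≤b
        hereS : Here s
        hereS = ≤-pred lo<s , <⇒≤ s≤hi
        hereTop : Here (suc s)
        hereTop = <⇒≤ lo<s , s≤hi
        F : Diagram
        F = move (suc s , b) (s , b) E
        mv : Moved (suc s , b) (s , b) E F
        mv = move-moved (suc s , b) (s , b) E
        u : UMove E F
        u = s , b , q , right , ≤-trans 1≤lo (≤-pred lo<s) ,
          (λ q' → 1+n≢n (uniq c₁<b hereTop hereS q q')) , mv
        off : ∀ {r r' c} → Outside c₁ lo hi r c → Here r' → (r , c) ≢ (r' , b)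
        off (inj₁ c≤c₁) _ refl = <⇒≱ c₁<b c≤c₁
        off (inj₂ (inj₁ r<lo)) (lo≤r , _) refl = <⇒≱ r<lo lo≤r
        off (inj₂ (inj₂ hi<r)) (_ , r≤hi) refl = <⇒≱ hi<r r≤hi
        out' : ∀ {r c} → Outside c₁ lo hi r c → ((r , c) ∈ D) ⇔ ((r , c) ∈ F)
        out' o = ⇔.trans (out o) (moved-agree mv (off o hereTop) (off o hereS))
        inColumn : ∀ {r} → Here r → (r , b) ∈ F → r ≡ s
        inColumn h q' with to (mv _) q'
        ... | inj₂ refl = refl
        ... | inj₁ (q'' , r≢) with refl ← uniq c₁<b h hereTop q'' q = contradiction refl r≢
        uniq' : ∀ {e r r'} → c₁ < e → Here r → Here r' → (r , e) ∈ F → (r' , e) ∈ F → r ≡ r'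
        uniq' {e} c₁<e h h' x y with e ≟ b
        ... | yes refl = trans (inColumn h x) (sym (inColumn h' y))
        ... | no e≢b = uniq c₁<e h h' (moved-old mv x (col≢ e≢b)) (moved-old mv y (col≢ e≢b))
        ex⇒ : ∀ {e} → c₁ < e → (hi , e) ∈ D → ∃[ r ] Here r × (r , e) ∈ F
        ex⇒ {e} c₁<e x with r , h , y ← to (ex c₁<e) x with (r , e) ≟C (suc s , b)
        ... | yes refl = s , hereS , moved-new mv
        ... | no r≢ = r , h , moved-keep mv y r≢
        ex⇐ : ∀ {e} → c₁ < e → ∃[ r ] Here r × (r , e) ∈ F → (hi , e) ∈ D
        ex⇐ c₁<e (r , h , x) with to (mv _) x
        ... | inj₁ (y , _) = from (ex c₁<e) (r , h , y)
        ... | inj₂ refl = from (ex c₁<e) (suc s , hereTop , q)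
      result : ∃[ E ] Tight D E × Lowered c₁ lo hi D E
      result with E , (tight , out , _ , ex) , gone ← exhaust {Inv} {Done} next D start =
        E , tight , record
          { outside = out
          ; gone = gone
          ; landed = λ c₁<c → mk⇔
              (λ x → let r , (lo≤r , r≤hi) , y = to (ex c₁<c) x in
                subst (λ r → (r , _) ∈ E) (≤-antisym (≮⇒≥ λ lo<r → gone c₁<c lo<r r≤hi y) lo≤r) y)
              (λ x → from (ex c₁<c) (lo , (≤-refl , lo≤hi) , x))
          }

    -- The cell is the last one of every row it leaves, and its column is empty down to row lo, so k
    -- unit moves suffice.
    fall : ∀ {D} c lo k → InP D₀ D → 1 ≤ lo → (k + lo , c) ∈ D →
      (∀ {r} → lo ≤ r → r < k + lo → (r , c) ∉ D) →
      (∀ {r c'} → lo < r → r ≤ k + lo → (r , c') ∈ D → c' ≤ c) →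
      ∃[ E ] Tight D E × Moved (k + lo , c) (lo , c) D E
    fall {D} c lo zero D∈P 1≤lo p _ _ = D , tight-refl D∈P , moved-refl _ D p
    fall {D} c lo (suc k) D∈P 1≤lo p empty right =
      let E , tight , mv' = fall {F} c lo k (proj₁ tF) 1≤lo (moved-new mv)
             (λ lo≤r r<h q → empty lo≤r (m<n⇒m<1+n r<h) (moved-old mv q (row≢ (<⇒≢ r<h))))
             (λ lo<r r≤h q → ≮⇒≥ λ c<c' → <⇒≱ c<c'
               (right lo<r (m≤n⇒m≤1+n r≤h) (moved-old mv q (col≢ (≢-sym (<⇒≢ c<c'))))))
      in E , tight-trans tF tight , moved-trans k∉D mv mv'
      where
      F : Diagram
      F = move (suc (k + lo) , c) (k + lo , c) D
      mv : Moved (suc (k + lo) , c) (k + lo , c) D F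
      mv = move-moved _ _ D
      k∉D : (k + lo , c) ∉ D
      k∉D = empty (m≤n+m lo k) ≤-refl
      tF : Tight D F
      tF = tight-unit D∈P (k + lo , c , p , (λ c' → right (s≤s (m≤n+m lo k)) ≤-refl) ,
        ≤-trans 1≤lo (m≤n+m lo k) , k∉D , mv)

  -- Two ways down from D to the same diagram: either (p + 1 , c₁) moves down
  -- before row r₃ is lowered onto row p + 1 and blocks it, or (r₂ , c₁) jumps
  -- over it afterwards.  Only the jump loses two rows in one cover.
  module TwoPaths {D p c₁ r₂ r₃ c₃} (D∈P : InP D₀ D) (1≤p : 1 ≤ p)
    (x₁∈ : (suc p , c₁) ∈ D) (p∉ : (p , c₁) ∉ D)
    (x₂∈ : (r₂ , c₁) ∈ D) (p<r₂ : suc p < r₂) (r₂≤r₃ : r₂ ≤ r₃)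
    (between : ∀ {r} → suc p < r → r < r₂ → (r , c₁) ∉ D)
    (x₃∈ : (r₃ , c₃) ∈ D) (c₁<c₃ : c₁ < c₃)
    (empty : ∀ {r c} → c₁ < c → suc p ≤ r → r < r₃ → (r , c) ∉ D)
    where

    p≤r₃ : suc p ≤ r₃
    p≤r₃ = ≤-trans (<⇒≤ p<r₂) r₂≤r₃

    abstract
      fallTo : ∀ lo {E} → suc p ≤ lo → lo ≤ r₂ → InP D₀ E → (r₂ , c₁) ∈ E →
        (∀ {r} → lo ≤ r → r < r₂ → (r , c₁) ∉ E) →
        (∀ {r c} → c₁ < c → suc p < r → r ≤ r₃ → (r , c) ∉ E) →
        ∃[ F ] Tight E F × Moved (r₂ , c₁) (lo , c₁) E F
      fallTo lo {E} p<lo lo≤r₂ E∈P q holes clear = subst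
        (λ r → (r , c₁) ∈ E → (∀ {r'} → lo ≤ r' → r' < r → (r' , c₁) ∉ E) →
               (∀ {r' c'} → lo < r' → r' ≤ r → (r' , c') ∈ E → c' ≤ c₁) →
               ∃[ F ] Tight E F × Moved (r , c₁) (lo , c₁) E F)
        (m∸n+n≡m lo≤r₂) (fall c₁ lo (r₂ ∸ lo) E∈P (≤-trans (s≤s z≤n) p<lo)) q holes
        (λ lo<r r≤r₂ q' → ≮⇒≥ λ c₁<c → clear c₁<c (≤-<-trans p<lo lo<r) (≤-trans r≤r₂ r₂≤r₃) q')

    -- First path: x₃ comes down to row p + 1, to the right of (p + 1 , c₁). Then (r₂ , c₁) falls to
    -- row p + 2, ready to jump.
    lowerA = lower c₁ (suc p) r₃ D∈P (s≤s z≤n) p≤r₃ empty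
    A₁ = proj₁ lowerA
    LA = proj₂ (proj₂ lowerA)
    module LA = Lowered LA

    inA₁ : ∀ {r} → ((r , c₁) ∈ D) ⇔ ((r , c₁) ∈ A₁)
    inA₁ = LA.outside (inj₁ ≤-refl)

    fallA = fallTo (suc (suc p)) (n≤1+n _) p<r₂ (proj₁ (proj₁ (proj₂ lowerA))) (to inA₁ x₂∈)
      (λ p<r r<r₂ q → between p<r r<r₂ (from inA₁ q)) LA.gone
    A₂ = proj₁ fallA
    mA₂ = proj₂ (proj₂ fallA)

    tightA : Tight D A₂
    tightA = tight-trans (proj₁ (proj₂ lowerA)) (proj₁ (proj₂ fallA))

    A₃ : Diagram
    A₃ = move (suc (suc p) , c₁) (p , c₁) A₂
    mA₃ : Moved (suc (suc p) , c₁) (p , c₁) A₂ A₃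
    mA₃ = move-moved _ _ A₂

    p<2+p : p < suc (suc p)
    p<2+p = n≤1+n _

    jumpA : Covers A₂ A₃ × rowSum A₂ ≡ suc (suc (rowSum A₃))
    jumpA = jump-Covers (moved-new mA₂)
      (λ c' q → ≮⇒≥ λ c₁<c' → LA.gone c₁<c' ≤-refl (≤-trans p<r₂ r₂≤r₃)
        (moved-old mA₂ q (col≢ (≢-sym (<⇒≢ c₁<c')))))
      (moved-keep mA₂ (to inA₁ x₁∈) (row≢ (<⇒≢ p<r₂)))
      (moved-keep mA₂ (to (LA.landed c₁<c₃) x₃∈) (col≢ (≢-sym (<⇒≢ c₁<c₃))))
      c₁<c₃ 1≤p
      (λ q → p∉ (from inA₁ (moved-old mA₂ q (row≢ (<⇒≢ p<2+p)))))
      mA₃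

    -- Second path: (p + 1 , c₁) steps down while still last in its row, so that (r₂ , c₁) can later
    -- fall all the way to row p + 1.
    B₁ : Diagram
    B₁ = move (suc p , c₁) (p , c₁) D
    mB₁ : Moved (suc p , c₁) (p , c₁) D B₁
    mB₁ = move-moved _ _ D

    tightB₁ : Tight D B₁
    tightB₁ = tight-unit D∈P (p , c₁ , x₁∈ ,
      (λ c' q → ≮⇒≥ λ c₁<c' → empty c₁<c' ≤-refl (<-≤-trans p<r₂ r₂≤r₃) q) , 1≤p , p∉ , mB₁)

    lowerB = lower c₁ (suc p) r₃ (proj₁ tightB₁) (s≤s z≤n) p≤r₃
      (λ c₁<c p≤r r<r₃ q → empty c₁<c p≤r r<r₃ (moved-old mB₁ q (col≢ (≢-sym (<⇒≢ c₁<c)))))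
    B₂ = proj₁ lowerB
    LB = proj₂ (proj₂ lowerB)
    module LB = Lowered LB

    inB₂ : ∀ {r} → ((r , c₁) ∈ B₁) ⇔ ((r , c₁) ∈ B₂)
    inB₂ = LB.outside (inj₁ ≤-refl)

    holesB : ∀ {r} → suc p ≤ r → r < r₂ → (r , c₁) ∉ B₁
    holesB {r} p<r r<r₂ q with r ≟ suc p
    ... | yes refl = moved-gone mB₁ (row≢ 1+n≢n) q
    ... | no r≢ = between (≤∧≢⇒< p<r (≢-sym r≢)) r<r₂ (moved-old mB₁ q (row≢ (≢-sym (<⇒≢ p<r))))

    fallB = fallTo (suc p) ≤-refl (<⇒≤ p<r₂) (proj₁ (proj₁ (proj₂ lowerB)))
      (to inB₂ (moved-keep mB₁ x₂∈ (row≢ (≢-sym (<⇒≢ p<r₂)))))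
      (λ p<r r<r₂ q → holesB p<r r<r₂ (from inB₂ q)) LB.gone
    B₃ = proj₁ fallB
    mB₃ = proj₂ (proj₂ fallB)

    tightB : Tight D B₃
    tightB = tight-trans tightB₁ (tight-trans (proj₁ (proj₂ lowerB)) (proj₁ (proj₂ fallB)))

    -- Both paths lower the same cells to the right of c₁ and fill rows p and p + 1 of column c₁,
    -- with the roles of x₁ and x₂ exchanged.
    same : B₃ ≈D A₃
    same z@(r , c) with c ≤? c₁
    ... | no c≰c₁ = ⇔.trans (⇔.sym (moved-agree mB₃ off off))
          (⇔.trans (Lowered-agree LB LA (λ c₁<c' → ⇔.sym (moved-agree mB₁ (col≢ (≢-sym (<⇒≢ c₁<c'))) (col≢ (≢-sym (<⇒≢ c₁<c'))))) (≰⇒> c≰c₁))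
          (⇔.trans (moved-agree mA₂ off off) (moved-agree mA₃ off off)))
      where
      off : ∀ {r'} → (r , c) ≢ (r' , c₁)
      off refl = c≰c₁ ≤-refl
    ... | yes c≤c₁ = mk⇔ fwd bwd
      where
      outA : ∀ {r} → ((r , c) ∈ D) ⇔ ((r , c) ∈ A₁)
      outA = LA.outside (inj₁ c≤c₁)
      outB : ∀ {r} → ((r , c) ∈ B₁) ⇔ ((r , c) ∈ B₂)
      outB = LB.outside (inj₁ c≤c₁)
      keepA : z ∈ D → z ≢ (r₂ , c₁) → z ∈ A₃
      keepA q z≢x₂ = moved-keep mA₃ (moved-keep mA₂ (to outA q) z≢x₂) z≢u
        where
        z≢u : z ≢ (suc (suc p) , c₁)
        z≢u refl = between ≤-refl (≤∧≢⇒< p<r₂ λ { refl → z≢x₂ refl }) q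
      fwd : z ∈ B₃ → z ∈ A₃
      fwd z∈B₃ with to (mB₃ z) z∈B₃
      ... | inj₂ refl = keepA x₁∈ (row≢ (<⇒≢ p<r₂))
      ... | inj₁ (z∈B₂ , z≢x₂) with to (mB₁ z) (from outB z∈B₂)
      ...   | inj₁ (z∈D , _) = keepA z∈D z≢x₂
      ...   | inj₂ refl = moved-new mA₃
      keepB : z ∈ B₁ → z ≢ (r₂ , c₁) → z ∈ B₃
      keepB q z≢x₂ = moved-keep mB₃ (to outB q) z≢x₂
      bwd : z ∈ A₃ → z ∈ B₃
      bwd z∈A₃ with to (mA₃ z) z∈A₃
      ... | inj₂ refl = keepB (moved-new mB₁) (row≢ (<⇒≢ (<-trans ≤-refl p<r₂)))
      ... | inj₁ (z∈A₂ , z≢u) with to (mA₂ z) z∈A₂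
      ...   | inj₂ z≡u = contradiction z≡u z≢u
      ...   | inj₁ (z∈A₁ , z≢x₂) with z ≟C (suc p , c₁)
      ...     | yes refl = moved-new mB₃
      ...     | no z≢x₁ = keepB (moved-keep mB₁ (from outA z∈A₁) z≢x₁) z≢x₂

    impossible : ⊥
    -- The second path makes ρ and the row sum drop equally. On the first the jump lowers ρ by one
    -- and the row sum by two, though both paths have the same ends.
    impossible = 1+n≢n (begin
      suc (suc (ρ D + rowSum A₃)) ≡⟨ cong suc (+-suc (ρ D) (rowSum A₃)) ⟨
      suc (ρ D + suc (rowSum A₃)) ≡⟨ +-suc (ρ D) (suc (rowSum A₃)) ⟨
      ρ D + suc (suc (rowSum A₃)) ≡⟨ cong (ρ D +_) (proj₂ jumpA) ⟨
      ρ D + rowSum A₂             ≡⟨ proj₂ tightA ⟩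
      ρ A₂ + rowSum D             ≡⟨ cong (_+ rowSum D) (ρ-covers A₃ A₂ A₃∈P (proj₁ tightA) (proj₁ jumpA)) ⟩
      suc (ρ A₃ + rowSum D)       ≡⟨ cong (λ n → suc (n + rowSum D)) (ρ-cong B₃ A₃ (proj₁ tightB) A₃∈P same) ⟨
      suc (ρ B₃ + rowSum D)       ≡⟨ cong suc (proj₂ tightB) ⟨
      suc (ρ D + rowSum B₃)       ≡⟨ cong (λ n → suc (ρ D + n)) (rowSum-cong same) ⟩
      suc (ρ D + rowSum A₃)       ∎)
      where
      open ≡-Reasoning
      A₃∈P : InP D₀ A₃
      A₃∈P = ⟶*-snoc (proj₁ tightA) (covers-KMove (proj₁ jumpA))

-- From a pattern to the two paths

lowest : ∀ D c lo x → (∀ {y} → lo < y → y < x → (y , c) ∉ D) ⊎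
  (∃[ r ] lo < r × r < x × (r , c) ∈ D × (∀ {y} → lo < y → y < r → (y , c) ∉ D))
lowest D c lo zero = inj₁ λ _ ()
lowest D c lo (suc x) with lowest D c lo x
... | inj₂ (r , lo<r , r<x , q , none) = inj₂ (r , lo<r , m<n⇒m<1+n r<x , q , none)
... | inj₁ none with lo <? x | (x , c) ∈? D
...   | yes lo<x | yes q = inj₂ (x , lo<x , ≤-refl , q , none)
...   | no lo≮x | _ = inj₁ λ lo<y y<1+x _ → lo≮x (<-≤-trans lo<y (≤-pred y<1+x))
...   | yes _ | no x∉D = inj₁ none'
  where
  none' : ∀ {y} → lo < y → y < suc x → (y , c) ∉ D
  none' {y} lo<y y<1+x with y ≟ x
  ... | yes refl = x∉D
  ... | no y≢x = none lo<y (≤∧≢⇒< (≤-pred y<1+x) y≢x)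

-- Serves to replace x₂ by the lowest cell above x₁ in its column, as `TwoPaths` wants the gap
-- between them empty.
nextAbove : ∀ {D c lo x} → lo < x → (x , c) ∈ D →
  ∃[ r ] lo < r × r ≤ x × (r , c) ∈ D × (∀ {y} → lo < y → y < r → (y , c) ∉ D)
nextAbove {D} {c} {lo} {x} lo<x x∈D with lowest D c lo x
... | inj₁ none = x , lo<x , ≤-refl , x∈D , none
... | inj₂ (r , lo<r , r<x , q , none) = r , lo<r , <⇒≤ r<x , q , none

module _ {D₀} (ne : Northeast D₀) (ranked : Ranked D₀) where

  private module R = Rank ranked

  -- The pattern with r₁ = p + 1, r₃ = m + 1, where (d) holds for all c > c₁
  -- and (c) only for c = c₁.
  record Pattern′ (c₁ p : ℕ) : Set where
    field
      {r₂ m t c₃} : ℕ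
      x₁∈ : (suc p , c₁) ∈ D₀
      x₂∈ : (r₂ , c₁) ∈ D₀
      x₃∈ : (suc m , c₃) ∈ D₀
      r₁<r₂ : suc p < r₂
      r₂≤r₃ : r₂ ≤ suc m
      c₁<c₃ : c₁ < c₃
      1≤t : 1 ≤ t
      t≤p : t ≤ p
      t∉ : (t , c₁) ∉ D₀
      few : ∀ c → c₁ < c → N D₀ c m < suc p

  -- Clearing rows p + 1 to m to the right of c₁ touches neither column c₁ nor row m + 1, so x₁, x₂
  -- and x₃ survive and `TwoPaths` applies.
  push : ∀ {D c₁ p r₂ m c₃} → InP D₀ D → 1 ≤ p → (suc p , c₁) ∈ D → (p , c₁) ∉ D →
    (r₂ , c₁) ∈ D → suc p < r₂ → r₂ ≤ suc m → (suc m , c₃) ∈ D → c₁ < c₃ →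
    (∀ c → c₁ < c → N D c m < suc p) → ⊥
  push {D} {c₁} {p} {r₂} {m} D∈P 1≤p x₁∈ p∉ x₂∈ p<r₂ r₂≤r₃ x₃∈ c₁<c₃ few
    with E , E∈P , same , empty ← clear c₁ (suc p) m D∈P few
    with r , p<r , r≤r₂ , q , none ← nextAbove p<r₂ (to (same (inj₁ ≤-refl)) x₂∈)
    = R.TwoPaths.impossible E∈P 1≤p (to (same (inj₁ ≤-refl)) x₁∈) (p∉ ∘ from (same (inj₁ ≤-refl)))
        q p<r (≤-trans r≤r₂ r₂≤r₃) none (to (same (inj₂ ≤-refl)) x₃∈) c₁<c₃
        λ c₁<c p<r r<r₃ → empty c₁<c p<r (≤-pred r<r₃)

  module _ {c₁ p} (P : Pattern′ c₁ p) where

    open Pattern′ P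

    1≤p : 1 ≤ p
    1≤p = ≤-trans 1≤t t≤p

    hole<p : (p , c₁) ∈ D₀ → t < p
    hole<p p∈ = ≤∧≢⇒< t≤p λ { refl → t∉ p∈ }

    -- With nothing to its right, (p , c₁) moves to the highest hole below it, after which `push`
    -- applies.
    vacate : (p , c₁) ∈ D₀ → (∀ x → x ∈ D₀ → ¬ (c₁ < proj₂ x × proj₁ x ≤ suc p)) → ⊥
    vacate p∈ none with r , 1≤r , r<p , r∉ , run ← highestHole D₀ c₁ p 1≤t (hole<p p∈) t∉ =
      push (step km (done ≈D-refl)) 1≤p (kept ≤-refl x₁∈) (moved-gone mv (row≢ (≢-sym (<⇒≢ r<p))))
        (kept (<⇒≤ r₁<r₂) x₂∈) r₁<r₂ r₂≤r₃ (kept (≤-trans (<⇒≤ r₁<r₂) r₂≤r₃) x₃∈) c₁<c₃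
        (λ c c₁<c → subst (_< suc p) (sym (N-moved-other p∈ 1≤r r<p r∉ mv m (≢-sym (<⇒≢ c₁<c)))) (few c c₁<c))
      where
      E : Diagram
      E = move (p , c₁) (r , c₁) D₀
      mv : Moved (p , c₁) (r , c₁) D₀ E
      mv = move-moved _ _ D₀
      km : KMove D₀ E
      km = p , c₁ , r , p∈ , (λ c' q → ≮⇒≥ λ c₁<c' → none _ q (c₁<c' , n≤1+n p)) , 1≤r , r<p , r∉ , run , mv
      kept : ∀ {s c} → p < s → (s , c) ∈ D₀ → (s , c) ∈ E
      kept p<s q = moved-keep mv q (row≢ (≢-sym (<⇒≢ p<s)))

    -- The new triple is (p , c₁), (p + 1 , c₁) and (p + 1 , c), the last by the northeast property.
    descend : ∀ {p' s c} → p ≡ suc p' → (p , c₁) ∈ D₀ → (s , c) ∈ D₀ → c₁ < c → s ≤ suc p → Pattern′ c₁ p'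
    descend {p'} {s} {c} refl p∈ q c₁<c s≤ = record
      { x₁∈ = p∈ ; x₂∈ = x₁∈ ; x₃∈ = northeast ne x₁∈ q s≤ (<⇒≤ c₁<c)
      ; r₁<r₂ = ≤-refl ; r₂≤r₃ = ≤-refl ; c₁<c₃ = c₁<c ; 1≤t = 1≤t
      ; t≤p = ≤-pred (hole<p p∈) ; t∉ = t∉ ; few = few' }
      where
      -- A column with a cell in rows up to p also has one in row p + 1 ≤ m, so the old bound
      -- improves by one.
      few' : ∀ c → c₁ < c → N D₀ c p < p
      few' c c₁<c with 0 <? N D₀ c p
      ... | no 0≮N = ≤-<-trans (≮⇒≥ 0≮N) 1≤p
      ... | yes 0<N with b , q' , b<p , _ ← N-find D₀ c 0 p 0<N =
              ≤-pred (≤-<-trans (≤-trans (≤-reflexive (sym (N-yes D₀ c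
                (northeast ne x₁∈ q' (≤-trans b<p (n≤1+n _)) (<⇒≤ c₁<c)))))
                (N-mono D₀ c (≤-pred (≤-trans r₁<r₂ r₂≤r₃)))) (few c c₁<c))

  -- If (p , c₁) is occupied, either it can be moved out of the way, or a cell to
  -- its right in a row ≤ p + 1 yields the same configuration one row lower.
  no-pattern′ : ∀ {c₁} p → ¬ Pattern′ c₁ p
  no-pattern′ {c₁} p P with (p , c₁) ∈? D₀
  ... | no p∉ = push (done ≈D-refl) (1≤p P) x₁∈ p∉ x₂∈ r₁<r₂ r₂≤r₃ x₃∈ c₁<c₃ few
    where open Pattern′ P
  no-pattern′ {c₁} p P | yes p∈ with search (λ x → (c₁ <? proj₂ x) ×-dec (proj₁ x ≤? suc p)) D₀
  no-pattern′ {c₁} p P | yes p∈ | inj₂ none = vacate P p∈ none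
  no-pattern′ {c₁} zero P | yes p∈ | inj₁ _ = contradiction (1≤p P) λ ()
  no-pattern′ {c₁} (suc p) P | yes p∈ | inj₁ (_ , q , c₁<c , s≤) =
    no-pattern′ p (descend P refl p∈ q c₁<c s≤)

  -- If some column strictly between c₁ and c₃ violates the bound (d), it holds two
  -- cells that can take over the roles of x₁ and x₂.
  no-pattern-from : ∀ n {c₁ p r₂ m c₃} → c₃ ≤ n + c₁ →
    (suc p , c₁) ∈ D₀ → (r₂ , c₁) ∈ D₀ → (suc m , c₃) ∈ D₀ →
    suc p < r₂ → r₂ ≤ suc m → c₁ < c₃ →
    (∀ c → c₁ ≤ c → c < c₃ → Σ ℕ λ r → (1 ≤ r) × (r < suc p) × ((r , c) ∉ D₀)) →
    (∀ c → c₃ ≤ c → N D₀ c m < suc p) → ⊥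
  no-pattern-from zero c₃≤c₁ _ _ _ _ _ c₁<c₃ = contradiction c₃≤c₁ (<⇒≱ c₁<c₃)
  no-pattern-from (suc n) {c₁} {p} {r₂} {m} {c₃} c₃≤ x₁∈ x₂∈ x₃∈ r₁<r₂ r₂≤r₃ c₁<c₃ holes few
    with t , 1≤t , t<r₁ , t∉ ← holes c₁ ≤-refl c₁<c₃
    with anyUpTo? (λ c → (c₁ <? c) ×-dec (suc p ≤? N D₀ c m)) c₃
  ... | no none = no-pattern′ p record
      { x₁∈ = x₁∈ ; x₂∈ = x₂∈ ; x₃∈ = x₃∈ ; r₁<r₂ = r₁<r₂ ; r₂≤r₃ = r₂≤r₃ ; c₁<c₃ = c₁<c₃
      ; 1≤t = 1≤t ; t≤p = ≤-pred t<r₁ ; t∉ = t∉ ; few = few' }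
    where
    few' : ∀ c → c₁ < c → N D₀ c m < suc p
    few' c c₁<c with c <? c₃
    ... | yes c<c₃ = ≰⇒> λ many → none (c , c<c₃ , c₁<c , many)
    ... | no c≮c₃ = few c (≮⇒≥ c≮c₃)
  ... | yes (c , c<c₃ , c₁<c , many)
    -- The hole in column c₁ gives p ≥ 1, so column c has at least two cells below r₃; y₁ and y₂ are
    -- the lowest two.
    with b₁ , y₁∈ , _ , Nb₁ ← N-find D₀ c 0 m (≤-trans (s≤s z≤n) many)
    with b₂ , y₂∈ , b₂<m , Nb₂ ← N-find D₀ c 1 m (≤-trans (s≤s (≤-trans 1≤t (≤-pred t<r₁))) many)
    -- If y₁ is not above row r₁, the northeast property copies x₁ and x₂ into column c. Otherwise
    -- y₁ and y₂ replace them, and the larger r₁ only weakens (c) and (d).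
    with b₁ ≤? p
  ...   | yes b₁≤p = no-pattern-from n (≤-shift n c₃≤ c₁<c) (northeast ne x₁∈ y₁∈ (s≤s b₁≤p) (<⇒≤ c₁<c))
            (northeast ne x₂∈ y₁∈ (≤-trans (s≤s b₁≤p) (<⇒≤ r₁<r₂)) (<⇒≤ c₁<c)) x₃∈ r₁<r₂ r₂≤r₃ c<c₃
            (λ e c≤e → holes e (≤-trans (<⇒≤ c₁<c) c≤e)) few
  ...   | no b₁≰p = no-pattern-from n (≤-shift n c₃≤ c₁<c) y₁∈ y₂∈ x₃∈
            (s≤s (N-cancel-< D₀ c (≤-reflexive (trans (cong suc Nb₁) (sym Nb₂))))) (m≤n⇒m≤1+n b₂<m) c<c₃
            (λ e c≤e e<c₃ → let r , 1≤r , r<r₁ , r∉ = holes e (≤-trans (<⇒≤ c₁<c) c≤e) e<c₃ in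
              r , 1≤r , <-trans r<r₁ (s≤s (≰⇒> b₁≰p)) , r∉)
            (λ e c₃≤e → <-trans (few e c₃≤e) (s≤s (≰⇒> b₁≰p)))

  ranked⇒noPattern : ¬ Pattern D₀
  ranked⇒noPattern (zero , c₁ , _ , _ , c₃ , _ , _ , _ , _ , _ , c₁<c₃ , holes , _)
    with _ , _ , () , _ ← holes c₁ ≤-refl c₁<c₃
  ranked⇒noPattern (suc p , c₁ , suc r₂ , suc m , c₃ , x₁∈ , x₂∈ , x₃∈ , r₁<r₂ , r₂≤r₃ , c₁<c₃ , holes , few) =
    no-pattern-from c₃ (m≤m+n c₃ c₁) x₁∈ x₂∈ x₃∈ r₁<r₂ r₂≤r₃ c₁<c₃ holes few

theorem1p4 : (D₀ : Diagram) → Positive D₀ → Northeast D₀ →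
    Ranked D₀ ⇔ (¬ Pattern D₀)
theorem1p4 D₀ _ ne = mk⇔ (ranked⇒noPattern ne) (noPattern⇒ranked ne)
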